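{- Every modularly extended simple matroid has a divisional flag. In particular, if $\mathcal{A}$ is a central hyperplane arrangement whose linear dependence matroid $M(\mathcal{A})$ is modularly extended, then $\mathcal{A}$ is divisionally free.
   Context: All matroids are finite. For a simple matroid $M$ on ground set $E$ with rank function $r$, flats are ordered by inclusion and form the geometric lattice $L(M)$; the join of flats $X,Y$ is $X\vee Y=\mathrm{cl}(X\cup Y)$. Elements of $E$ are called atoms; a coatom is a flat of rank $r(E)-1$. A flat $X$ is modular if $r(X)+r(Y)=r(X\cap Y)+r(X\vee Y)$ for every flat $Y$. $M|X$ is the restriction, $M/X$ the contraction (whose lattice of flats is the interval $\{F\in L(M): X\subseteq F\}$), and $\mathrm{si}(N)$ the simplification of a matroid $N$. The characteristic polynomial is $\chi(M,t)=\sum_{X\in L(M)}\mu(X)t^{r(E)-r(X)}$, where $\mu(\varnothing)=1$ and $\mu(X)=-\sum_{Y\subsetneq X,\,Y\in L(M)}\mu(Y)$; for a contraction it is computed from its lattice of flats, so $\chi(M/X,t)=\chi(\mathrm{si}(M/X),t)$. A simple matroid $M$ is a modular join if $E=E_1\cup E_2$ for two proper modular flats $E_1,E_2$; then one writes $M=P_X(E_1,E_2)=P_X(M|E_1,M|E_2)$ with $X=E_1\cap E_2$ ("modular join over $X$"). A matroid is round if its ground set is not the union of two proper flats; a flat $S$ is round if $M|S$ is round. The class $\mathcal{ME}$ of modularly extended matroids is the smallest class of simple matroids such that: (i) the empty matroid is in $\mathcal{ME}$; (ii) if a simple matroid $M$ has a modular coatom $X$ with $M|X\in\mathcal{ME}$,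 then $M\in\mathcal{ME}$; (iii) if $M$ is a modular join $P_X(M_1,M_2)$ over a round flat $X$ with $M_1,M_2\in\mathcal{ME}$, then $M\in\mathcal{ME}$. A divisional flag of a simple matroid $M$ of rank $n$ is a chain of flats $\varnothing=X_0\subseteq X_1\subseteq\dots\subseteq X_n=E$ with $r(X_i)=i$ for all $i$ and $\chi(M/X_{i+1},t)$ dividing $\chi(M/X_i,t)$ for $i=0,\dots,n-1$. A central hyperplane arrangement $\mathcal{A}$ is a finite set of linear hyperplanes in $\mathbb{K}^\ell$ ($\mathbb{K}$ a field); its linear dependence matroid $M(\mathcal{A})$ is the simple matroid on $\mathcal{A}$ in which $\{H_1,\dots,H_k\}$ is independent iff $H_1\cap\dots\cap H_k$ has codimension $k$. $\mathcal{A}$ is divisionally free if $M(\mathcal{A})$ has a divisional flag. -}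

module Defs where

open import Data.Bool using (Bool; true; false; _∧_; if_then_else_)
import Data.Bool.Properties as BoolP
open import Data.Nat as ℕ using (ℕ; zero; suc; _≤_; _<_; _∸_)
import Data.Nat.Properties as ℕP
open import Data.Integer as ℤ using (ℤ; 0ℤ; 1ℤ; -_)
open import Data.Fin using (Fin)
open import Data.Fin.Subset
  using (Subset; _∪_; _∩_; _⊆_; _⊂_; _∈_; ⁅_⁆; ∣_∣; inside; outside)
  renaming (⊥ to ∅)
open import Data.Fin.Subset.Properties using (_∈?_; _⊆?_; _⊂?_)
open import Data.List using (List; []; _∷_; _++_; map; filterᵇ; foldr; upTo)
open import Data.Vec using (Vec; []; _∷_; tabulate)
import Data.Vec.Properties as VecP
open import Data.Product using (Σ; ∃; ∃-syntax; _×_; _,_)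
open import Relation.Nullary using (¬_; Dec; ⌊_⌋)
open import Relation.Binary.PropositionalEquality using (_≡_; _≢_)

_≟ₛ_ : ∀ {n} (X Y : Subset n) → Dec (X ≡ Y)
_≟ₛ_ = VecP.≡-dec BoolP._≟_

allSubsets : ∀ n → List (Subset n)
allSubsets zero    = [] ∷ []
allSubsets (suc n) = map (inside ∷_) (allSubsets n) ++ map (outside ∷_) (allSubsets n)

-- Matroids (given by a rank function) with ground set E ⊆ Fin n.
-- The rank axioms are required for subsets of the ground set E;
-- the values of r on other subsets of Fin n are irrelevant.

record Matroid (n : ℕ) : Set where
  field
    E  : Subset n
    r  : Subset n → ℕ
    r-bound  : ∀ X → X ⊆ E → r X ≤ ∣ X ∣
    r-mono   : ∀ X Y → X ⊆ Y → Y ⊆ E → r X ≤ r Y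
    r-submod : ∀ X Y → X ⊆ E → Y ⊆ E →
               r (X ∪ Y) ℕ.+ r (X ∩ Y) ≤ r X ℕ.+ r Y

open Matroid public

private
  ⊆-trans : ∀ {n} {X Y Z : Subset n} → X ⊆ Y → Y ⊆ Z → X ⊆ Z
  ⊆-trans p q x = q (p x)

_∣_ : ∀ {n} (M : Matroid n) (S : Subset n) → S ⊆ E M → Matroid n
(M ∣ S) S⊆E = record
  { E = S
  ; r = r M
  ; r-bound  = λ X X⊆S → r-bound M X (⊆-trans X⊆S S⊆E)
  ; r-mono   = λ X Y X⊆Y Y⊆S → r-mono M X Y X⊆Y (⊆-trans Y⊆S S⊆E)
  ; r-submod = λ X Y X⊆S Y⊆S → r-submod M X Y (⊆-trans X⊆S S⊆E) (⊆-trans Y⊆S S⊆E)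
  }

module _ {n : ℕ} (M : Matroid n) where

  rank : ℕ
  rank = r M (E M)

  Simple : Set
  Simple = (∀ e → e ∈ E M → r M ⁅ e ⁆ ≡ 1)
         × (∀ e f → e ∈ E M → f ∈ E M → e ≢ f → r M (⁅ e ⁆ ∪ ⁅ f ⁆) ≡ 2)

  cl : Subset n → Subset n
  cl X = tabulate (λ e → ⌊ e ∈? E M ⌋ ∧ ⌊ r M (X ∪ ⁅ e ⁆) ℕ.≟ r M X ⌋)

  IsFlat : Subset n → Set
  IsFlat X = cl X ≡ X

  isFlat? : (X : Subset n) → Dec (IsFlat X)
  isFlat? X = cl X ≟ₛ X

  _∨_ : Subset n → Subset n → Subset n
  X ∨ Y = cl (X ∪ Y)

  IsProperFlat : Subset n → Set
  IsProperFlat X = IsFlat X × X ≢ E M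

  IsCoatom : Subset n → Set
  IsCoatom X = IsFlat X × suc (r M X) ≡ rank

  IsModularFlat : Subset n → Set
  IsModularFlat X = IsFlat X ×
    (∀ Y → IsFlat Y → r M X ℕ.+ r M Y ≡ r M (X ∩ Y) ℕ.+ r M (X ∨ Y))

  IsModularJoin : Subset n → Subset n → Set
  IsModularJoin E₁ E₂ = E M ≡ E₁ ∪ E₂
    × IsProperFlat E₁ × IsModularFlat E₁
    × IsProperFlat E₂ × IsModularFlat E₂

  Round : Set
  Round = ¬ (∃[ F₁ ] ∃[ F₂ ] (IsProperFlat F₁ × IsProperFlat F₂ × E M ≡ F₁ ∪ F₂))

  -- Möbius function of the interval [X, F] of the lattice of flats,
  -- μ_X(X) = 1,  μ_X(F) = - Σ_{G flat, X ⊆ G ⊊ F} μ_X(G).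
  -- Computed with a fuel parameter k; any fuel k ≥ ∣F∣ gives the true value
  -- (strict chains below F have length ≤ ∣F∣), we use fuel suc n.

  sumℤ : List ℤ → ℤ
  sumℤ = foldr ℤ._+_ 0ℤ

  flatsBetween : Subset n → Subset n → List (Subset n)
  flatsBetween X F =
    filterᵇ (λ G → ⌊ isFlat? G ⌋ ∧ (⌊ X ⊆? G ⌋ ∧ ⌊ G ⊂? F ⌋)) (allSubsets n)

  μ′ : ℕ → Subset n → Subset n → ℤ
  μ′ zero    X F = if ⌊ F ≟ₛ X ⌋ then 1ℤ else 0ℤ
  μ′ (suc k) X F = if ⌊ F ≟ₛ X ⌋ then 1ℤ
                   else - sumℤ (map (μ′ k X) (flatsBetween X F))

  μ : Subset n → Subset n → ℤ
  μ X F = μ′ (suc n) X F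

  -- Characteristic polynomial of the contraction M/X (X a flat), computed from
  -- its lattice of flats {F flat | X ⊆ F}:
  --   χ(M/X, t) = Σ_{F flat, X ⊆ F} μ_X(F) t^{r(E) - r(F)}.
  -- A polynomial is represented by its coefficient function ℕ → ℤ;
  -- χContr X k is the coefficient of t^k.
  χContr : Subset n → ℕ → ℤ
  χContr X k = sumℤ (map (μ X)
     (filterᵇ (λ F → ⌊ isFlat? F ⌋ ∧ (⌊ X ⊆? F ⌋ ∧ ⌊ rank ∸ r M F ℕ.≟ k ⌋))
              (allSubsets n)))

coeffs : List ℤ → ℕ → ℤ
coeffs []       _       = 0ℤ
coeffs (a ∷ as) zero    = a
coeffs (a ∷ as) (suc k) = coeffs as k

polyMul : (ℕ → ℤ) → (ℕ → ℤ) → ℕ → ℤ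
polyMul p q k = foldr ℤ._+_ 0ℤ (map (λ j → p j ℤ.* q (k ∸ j)) (upTo (suc k)))

_∣ₚ_ : (ℕ → ℤ) → (ℕ → ℤ) → Set
d ∣ₚ p = ∃[ q ] (∀ k → p k ≡ polyMul (coeffs q) d k)

HasDivisionalFlag : ∀ {n} → Matroid n → Set
HasDivisionalFlag {n} M = Σ (ℕ → Subset n) λ X →
    ( X 0 ≡ ∅
    × X (rank M) ≡ E M
    × (∀ i → i ≤ rank M → IsFlat M (X i) × r M (X i) ≡ i)
    × (∀ i → i < rank M → X i ⊆ X (suc i))
    × (∀ i → i < rank M → χContr M (X (suc i)) ∣ₚ χContr M (X i)))

data ME {n : ℕ} : Matroid n → Set where
  empty  : (M : Matroid n) → E M ≡ ∅ → ME M
  coatom : (M : Matroid n) → Simple M →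
           (X : Subset n) (X⊆E : X ⊆ E M) →
           IsModularFlat M X → IsCoatom M X →
           ME ((M ∣ X) X⊆E) → ME M
  join   : (M : Matroid n) → Simple M →
           (E₁ E₂ : Subset n) (E₁⊆E : E₁ ⊆ E M) (E₂⊆E : E₂ ⊆ E M) →
           IsModularJoin M E₁ E₂ →
           IsFlat M (E₁ ∩ E₂) → (X⊆E : (E₁ ∩ E₂) ⊆ E M) →
           Round ((M ∣ (E₁ ∩ E₂)) X⊆E) →
           ME ((M ∣ E₁) E₁⊆E) → ME ((M ∣ E₂) E₂⊆E) → ME M

{-# OPTIONS --safe #-}
module Submission where

-- By induction on ME one proves more: for every round modular flat X there is a chain of flats from ∅ to a
-- complement C of X (r(C) + r(X) = r(E), C ∨ X = E) along which each characteristic polynomial divides the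
-- previous one.  Three facts on a modular flat Z drive the induction.
-- (1) If C is a complement of Z, then [C, E] ≅ [∅, Z], so χ(M/(C ∨ F)) = χ((M|Z)/F) for flats F ⊆ Z.
-- (2) χ(M/F) = Q_F · χ((M|Z)/F) for flats F ⊆ Z, where Q_F is the sum of μ_F(V) t^(…) over flats V with V ∩ Z = F.
-- (3) If E = Z ∪ X with X modular as well, then Q_F is the same for all F ⊆ Z with F ∩ X = ∅.
-- Modular coatom Z: if some h lies outside Z ∪ X, prepend ∅ → h to the chain of M|Z for (X ∨ h) ∩ Z, lifted by (1);
-- otherwise E = Z ∪ X, and by (2) and (3) the chain of M|Z for X ∩ Z is already a chain of M.
-- Modular join: X is round, so X ⊆ E₁, say.  By (2) and (3) the chain of M|E₂ for E₁ ∩ E₂ is a chain of M; it ends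
-- in a complement C of E₁, and (1) lifts the chain of M|E₁ for X to one from C on.

open import Defs
open import Data.Bool using (Bool; true; false; _∧_; if_then_else_)
open import Data.Nat as ℕ using (ℕ; zero; suc; _≤_; _<_; z≤n; s≤s)
import Data.Nat.Properties as ℕₚ
open import Data.Nat.Solver using (module +-*-Solver)
open import Data.Integer using (ℤ; 0ℤ; 1ℤ; _+_; _*_; -_)
import Data.Integer.Properties as ℤₚ
open import Data.Integer.Tactic.RingSolver using (solve-∀)
open import Data.List using (List; []; _∷_; _++_; map; filterᵇ; foldr; upTo; applyUpTo)
open import Data.List.Properties using (map-applyUpTo)
open import Data.Vec using ([]; _∷_)
import Data.Vec.Properties as Vecₚ
open import Data.Fin using (Fin)
open import Data.Fin.Properties using (any?)
open import Data.Fin.Subset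
  using (Subset; inside; outside; _∪_; _∩_; _⊆_; _⊂_; _∈_; _∉_; ⁅_⁆; ∣_∣; Empty)
  renaming (⊥ to ∅)
open import Data.Fin.Subset.Properties
open import Data.Product using (_×_; _,_; proj₁; proj₂; ∃-syntax)
open import Data.Sum using (_⊎_; inj₁; inj₂; [_,_]′)
open import Data.Empty using (⊥-elim)
open import Relation.Nullary using (¬_; Dec; yes; no; ⌊_⌋; ¬?; _×-dec_)
open import Relation.Binary.Construct.Closure.ReflexiveTransitive
  using (Star; ε; _◅_; _◅◅_; gmap)
open import Relation.Binary.PropositionalEquality
  using (_≡_; _≢_; refl; sym; trans; cong; cong₂; subst; subst₂; module ≡-Reasoning)
open import Algebra.Properties.AbelianGroup ℤₚ.+-0-abelianGroup
  using () renaming (∙-cancelʳ to +-cancelʳ)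
open import Algebra.Properties.CommutativeSemigroup ℤₚ.+-commutativeSemigroup
  using (interchange)

-- The obstacle is the modular join. Fact (3) keeps a chain of M|E₂ divisional in M only for flats
-- that avoid E₁, so the induction hypothesis has to provide a chain that avoids E₁ ∩ E₂ for as long
-- as possible, that is, up to a complement of E₁ ∩ E₂. This is why complements enter the statement.
-- The theorem is the case X = ∅, whose complement is E. Roundness is the condition on X that
-- survives the induction: the flat over which a join is formed is round by definition of ME, a
-- round X cannot be split by the two parts of a join, and the image of X under contraction of a
-- point is again round. In the coatom case the first point h has to lie outside Z in order to be a
-- complement of Z, and outside X in order to start a chain towards a complement of X. If there is
-- no such h, then E = Z ∪ X, which is the situation of a join. Divisibility is carried by explicit
-- quotients. When two polynomials are multiplied by the same Q, the old quotient still works, so no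
-- polynomial is ever cancelled.

private variable
  n : ℕ
  Φ Ψ I J : Set
  A B C X Y Z : Subset n

-- Sums over subsets

-- Iverson bracket. A sum over flats with some property is written as a sum over all subsets with
-- masked summands, so that all sums run over one list and can be exchanged freely.
when : Dec Φ → ℤ → ℤ
when (yes _) x = x
when (no _)  x = 0ℤ

when-yes : (d : Dec Φ) → Φ → ∀ x → when d x ≡ x
when-yes (yes _) a x = refl
when-yes (no ¬a) a x = ⊥-elim (¬a a)

when-no : (d : Dec Φ) → ¬ Φ → ∀ x → when d x ≡ 0ℤ
when-no (yes a) ¬a x = ⊥-elim (¬a a)
when-no (no _)  ¬a x = refl

when-⇔ : (d : Dec Φ) (e : Dec Ψ) → (Φ → Ψ) → (Ψ → Φ) → ∀ {x y} → (Φ → x ≡ y) → when d x ≡ when e y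
when-⇔ (yes a) e f g eq = trans (eq a) (sym (when-yes e (f a) _))
when-⇔ (no ¬a) e f g eq = sym (when-no e (λ b → ¬a (g b)) _)

when-cong : (d : Dec Φ) → ∀ {x y} → (Φ → x ≡ y) → when d x ≡ when d y
when-cong d = when-⇔ d d (λ a → a) (λ a → a)

when-0 : (d : Dec Φ) → when d 0ℤ ≡ 0ℤ
when-0 (yes _) = refl
when-0 (no _)  = refl

when-*ˡ : (d : Dec Φ) → ∀ c x → when d (c * x) ≡ c * when d x
when-*ˡ (yes _) c x = refl
when-*ˡ (no _)  c x = sym (ℤₚ.*-zeroʳ c)

when-*ʳ : (d : Dec Φ) → ∀ c x → when d (x * c) ≡ when d x * c
when-*ʳ (yes _) c x = refl
when-*ʳ (no _)  c x = refl

when-comm : (d : Dec Φ) (e : Dec Ψ) → ∀ x → when d (when e x) ≡ when e (when d x)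
when-comm (yes _) e x = refl
when-comm (no _)  e x = sym (when-0 e)

sumL : List I → (I → ℤ) → ℤ
sumL []       f = 0ℤ
sumL (x ∷ xs) f = f x + sumL xs f

sum-filterᵇ : (p : I → Bool) (f : I → ℤ) (xs : List I) →
  foldr _+_ 0ℤ (map f (filterᵇ p xs)) ≡ sumL xs (λ x → if p x then f x else 0ℤ)
sum-filterᵇ p f [] = refl
sum-filterᵇ p f (x ∷ xs) with p x
... | true  = cong (f x +_) (sum-filterᵇ p f xs)
... | false = trans (sum-filterᵇ p f xs) (sym (ℤₚ.+-identityˡ _))

sumL-++ : (xs ys : List I) (f : I → ℤ) → sumL (xs ++ ys) f ≡ sumL xs f + sumL ys f
sumL-++ []       ys f = sym (ℤₚ.+-identityˡ _)
sumL-++ (x ∷ xs) ys f = trans (cong (f x +_) (sumL-++ xs ys f)) (sym (ℤₚ.+-assoc (f x) _ _))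

sumL-map : (xs : List J) (h : J → I) (f : I → ℤ) → sumL (map h xs) f ≡ sumL xs (λ x → f (h x))
sumL-map []       h f = refl
sumL-map (x ∷ xs) h f = cong (f (h x) +_) (sumL-map xs h f)

sumL-cong : (xs : List I) {f g : I → ℤ} → (∀ x → f x ≡ g x) → sumL xs f ≡ sumL xs g
sumL-cong []       eq = refl
sumL-cong (x ∷ xs) eq = cong₂ _+_ (eq x) (sumL-cong xs eq)

sumL-0 : (xs : List I) → sumL xs (λ _ → 0ℤ) ≡ 0ℤ
sumL-0 []       = refl
sumL-0 (x ∷ xs) = trans (ℤₚ.+-identityˡ _) (sumL-0 xs)

sumL-+ : (xs : List I) (f g : I → ℤ) → sumL xs (λ x → f x + g x) ≡ sumL xs f + sumL xs g
sumL-+ []       f g = refl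
sumL-+ (x ∷ xs) f g = trans (cong (f x + g x +_) (sumL-+ xs f g)) (interchange (f x) (g x) _ _)

sumL-* : (xs : List I) → ∀ c (f : I → ℤ) → sumL xs (λ x → c * f x) ≡ c * sumL xs f
sumL-* []       c f = sym (ℤₚ.*-zeroʳ c)
sumL-* (x ∷ xs) c f = trans (cong (c * f x +_) (sumL-* xs c f)) (sym (ℤₚ.*-distribˡ-+ c (f x) _))

sumL-swap : (xs : List I) (ys : List J) (f : I → J → ℤ) →
            sumL xs (λ x → sumL ys (f x)) ≡ sumL ys (λ y → sumL xs (λ x → f x y))
sumL-swap []       ys f = sym (sumL-0 ys)
sumL-swap (x ∷ xs) ys f = trans (cong (sumL ys (f x) +_) (sumL-swap xs ys f)) (sym (sumL-+ ys (f x) _))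

-- Opaque, because otherwise the index n could not be inferred from a sum.
opaque

  Σₛ : (Subset n → ℤ) → ℤ
  Σₛ {n} = sumL (allSubsets n)

  Σₛ-def : (f : Subset n → ℤ) → Σₛ f ≡ sumL (allSubsets n) f
  Σₛ-def f = refl

  Σ-cong : {f g : Subset n → ℤ} → (∀ X → f X ≡ g X) → Σₛ f ≡ Σₛ g
  Σ-cong {n} = sumL-cong (allSubsets n)

  Σ-0 : {f : Subset n → ℤ} → (∀ X → f X ≡ 0ℤ) → Σₛ f ≡ 0ℤ
  Σ-0 {n} eq = trans (Σ-cong eq) (sumL-0 (allSubsets n))

  Σ-+ : (f g : Subset n → ℤ) → Σₛ (λ X → f X + g X) ≡ Σₛ f + Σₛ g
  Σ-+ {n} = sumL-+ (allSubsets n)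

  Σ-*ˡ : ∀ c (f : Subset n → ℤ) → Σₛ (λ X → c * f X) ≡ c * Σₛ f
  Σ-*ˡ {n} = sumL-* (allSubsets n)

  Σ-swap : (f : Subset n → Subset n → ℤ) → Σₛ (λ X → Σₛ (f X)) ≡ Σₛ (λ Y → Σₛ (λ X → f X Y))
  Σ-swap {n} = sumL-swap (allSubsets n) (allSubsets n)

Σ-*ʳ : ∀ c (f : Subset n → ℤ) → Σₛ (λ X → f X * c) ≡ Σₛ f * c
Σ-*ʳ c f = trans (Σ-cong (λ X → ℤₚ.*-comm (f X) c)) (trans (Σ-*ˡ c f) (ℤₚ.*-comm c _))

Σ-when : (d : Dec Φ) (f : Subset n → ℤ) → Σₛ (λ X → when d (f X)) ≡ when d (Σₛ f)
Σ-when (yes _) f = refl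
Σ-when (no _)  f = Σ-0 (λ _ → refl)

opaque
  unfolding Σₛ

  -- This is the form in which it is used that `allSubsets` lists every subset exactly once. By
  -- induction, only the half with first entry `b` contributes.
  Σ-δ : (Y : Subset n) (f : Subset n → ℤ) → Σₛ (λ X → when (X ≟ₛ Y) (f X)) ≡ f Y
  Σ-δ {zero}  []      f = ℤₚ.+-identityʳ _
  Σ-δ {suc n} (b ∷ Y) f = begin
    sumL (map (inside ∷_) (allSubsets n) ++ map (outside ∷_) (allSubsets n)) g
      ≡⟨ sumL-++ (map (inside ∷_) (allSubsets n)) _ g ⟩
    sumL (map (inside ∷_) (allSubsets n)) g + sumL (map (outside ∷_) (allSubsets n)) g
      ≡⟨ cong₂ _+_ (sumL-map (allSubsets n) _ g) (sumL-map (allSubsets n) _ g) ⟩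
    Σₛ (λ X → g (inside ∷ X)) + Σₛ (λ X → g (outside ∷ X))
      ≡⟨ halves b refl ⟩
    f (b ∷ Y) ∎
    where
    open ≡-Reasoning
    g : Subset (suc n) → ℤ
    g X = when (X ≟ₛ (b ∷ Y)) (f X)
    same : Σₛ (λ X → g (b ∷ X)) ≡ f (b ∷ Y)
    same = trans (Σ-cong (λ X → when-⇔ ((b ∷ X) ≟ₛ (b ∷ Y)) (X ≟ₛ Y) Vecₚ.∷-injectiveʳ (cong (b ∷_)) (λ _ → refl)))
                 (Σ-δ Y (λ X → f (b ∷ X)))
    other : ∀ c → c ≢ b → Σₛ (λ X → g (c ∷ X)) ≡ 0ℤ
    other c c≢b = Σ-0 (λ X → when-no ((c ∷ X) ≟ₛ (b ∷ Y)) (λ eq → c≢b (Vecₚ.∷-injectiveˡ eq)) _)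
    halves : ∀ c → c ≡ b → Σₛ (λ X → g (inside ∷ X)) + Σₛ (λ X → g (outside ∷ X)) ≡ f (b ∷ Y)
    halves true  refl = trans (cong₂ _+_ same (other false (λ ()))) (ℤₚ.+-identityʳ _)
    halves false refl = trans (cong₂ _+_ (other true (λ ())) same) (ℤₚ.+-identityˡ _)

module _ {P Q : Subset n → Set} (P? : ∀ X → Dec (P X)) (Q? : ∀ X → Dec (Q X))
         {f g : Subset n → ℤ} (φ ψ : Subset n → Subset n)
         (φ-Q : ∀ X → P X → Q (φ X)) (ψ-P : ∀ Y → Q Y → P (ψ Y))
         (ψφ : ∀ X → P X → ψ (φ X) ≡ X) (φψ : ∀ Y → Q Y → φ (ψ Y) ≡ Y)
         (f≡gφ : ∀ X → P X → f X ≡ g (φ X)) where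

  -- The graph of `φ` is inserted as a Kronecker delta and rewritten as the graph of `ψ`; the
  -- bijection then becomes an exchange of two summations.
  Σ-reindex : Σₛ (λ X → when (P? X) (f X)) ≡ Σₛ (λ Y → when (Q? Y) (g Y))
  Σ-reindex = begin
    Σₛ (λ X → when (P? X) (f X))
      ≡⟨ Σ-cong (λ X → when-cong (P? X) (λ _ → sym (Σ-δ (φ X) (λ _ → f X)))) ⟩
    Σₛ (λ X → when (P? X) (Σₛ (λ Y → when (Y ≟ₛ φ X) (f X))))
      ≡⟨ Σ-cong (λ X → sym (Σ-when (P? X) _)) ⟩
    Σₛ (λ X → Σₛ (λ Y → when (P? X) (when (Y ≟ₛ φ X) (f X))))
      ≡⟨ Σ-cong (λ X → Σ-cong (λ Y → graph X Y)) ⟩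
    Σₛ (λ X → Σₛ (λ Y → when (Q? Y) (when (X ≟ₛ ψ Y) (g Y))))
      ≡⟨ Σ-swap _ ⟩
    Σₛ (λ Y → Σₛ (λ X → when (Q? Y) (when (X ≟ₛ ψ Y) (g Y))))
      ≡⟨ Σ-cong (λ Y → Σ-when (Q? Y) _) ⟩
    Σₛ (λ Y → when (Q? Y) (Σₛ (λ X → when (X ≟ₛ ψ Y) (g Y))))
      ≡⟨ Σ-cong (λ Y → when-cong (Q? Y) (λ _ → Σ-δ (ψ Y) (λ _ → g Y))) ⟩
    Σₛ (λ Y → when (Q? Y) (g Y)) ∎
    where
    open ≡-Reasoning
    graph : ∀ X Y → when (P? X) (when (Y ≟ₛ φ X) (f X)) ≡ when (Q? Y) (when (X ≟ₛ ψ Y) (g Y))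
    graph X Y with P? X | Q? Y
    ... | yes p | yes q = when-⇔ (Y ≟ₛ φ X) (X ≟ₛ ψ Y) (λ eq → trans (sym (ψφ X p)) (cong ψ (sym eq)))
                            (λ eq → trans (sym (φψ Y q)) (cong φ (sym eq)))
                            (λ eq → trans (f≡gφ X p) (cong g (sym eq)))
    ... | yes p | no ¬q = when-no (Y ≟ₛ φ X) (λ eq → ¬q (subst Q (sym eq) (φ-Q X p))) _
    ... | no ¬p | yes q = sym (when-no (X ≟ₛ ψ Y) (λ eq → ¬p (subst P (sym eq) (ψ-P Y q))) _)
    ... | no _  | no _  = refl

-- Multiplication of coefficient sequences by polynomials

-- Multiplication by the e-th power of t.
shift : ℕ → (ℕ → ℤ) → ℕ → ℤ
shift zero    d k       = d k
shift (suc e) d zero    = 0ℤ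
shift (suc e) d (suc k) = shift e d k

shift-cong : ∀ e {d d′} → (∀ k → d k ≡ d′ k) → ∀ k → shift e d k ≡ shift e d′ k
shift-cong zero    eq k       = eq k
shift-cong (suc e) eq zero    = refl
shift-cong (suc e) eq (suc k) = shift-cong e eq k

shift-Σ : ∀ {n} e (f : Subset n → ℕ → ℤ) k → shift e (λ k → Σₛ (λ X → f X k)) k ≡ Σₛ (λ X → shift e (f X) k)
shift-Σ zero    f k       = refl
shift-Σ (suc e) f zero    = sym (Σ-0 (λ _ → refl))
shift-Σ (suc e) f (suc k) = shift-Σ e f k

shift-* : ∀ e c d k → shift e (λ k → c * d k) k ≡ c * shift e d k
shift-* zero    c d k       = refl
shift-* (suc e) c d zero    = sym (ℤₚ.*-zeroʳ c)
shift-* (suc e) c d (suc k) = shift-* e c d k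

shift-when : ∀ e (p : Dec Φ) d k → shift e (λ k → when p (d k)) k ≡ when p (shift e d k)
shift-when zero    p d k       = refl
shift-when (suc e) p d zero    = sym (when-0 p)
shift-when (suc e) p d (suc k) = shift-when e p d k

t^_ : ℕ → ℕ → ℤ
(t^ e) k = when (e ℕ.≟ k) 1ℤ

shift-t^ : ∀ e a k → shift e (t^ a) k ≡ (t^ (e ℕ.+ a)) k
shift-t^ zero    a k       = refl
shift-t^ (suc e) a zero    = refl
shift-t^ (suc e) a (suc k) =
  trans (shift-t^ e a k)
        (when-⇔ (e ℕ.+ a ℕ.≟ k) (suc (e ℕ.+ a) ℕ.≟ suc k) (cong suc) (λ { refl → refl }) (λ _ → refl))

-- The product with the polynomial `q` by Horner's rule, (a + t q) d = a d + t (q d). Unlike the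
-- convolution in `polyMul` it is structurally recursive, so its algebra is proved by plain
-- induction.
act : List ℤ → (ℕ → ℤ) → ℕ → ℤ
act []      d k = 0ℤ
act (a ∷ q) d k = a * d k + shift 1 (act q d) k

-- Splitting off the term j = 0 of the convolution leaves the convolution of `q` with `d` at k,
-- since suc k ∸ suc j reduces to k ∸ j.
polyMul≡act : ∀ q d k → polyMul (coeffs q) d k ≡ act q d k
polyMul≡act []      d k = zeros (upTo (suc k))
  where
  zeros : ∀ js → foldr _+_ 0ℤ (map (λ j → 0ℤ * d (k ℕ.∸ j)) js) ≡ 0ℤ
  zeros []       = refl
  zeros (j ∷ js) = trans (ℤₚ.+-identityˡ _) (zeros js)
polyMul≡act (a ∷ q) d zero    = refl
polyMul≡act (a ∷ q) d (suc k) = cong (a * d (suc k) +_) (begin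
  foldr _+_ 0ℤ (map (λ j → coeffs (a ∷ q) j * d (suc k ℕ.∸ j)) (applyUpTo suc (suc k)))
    ≡⟨ cong (foldr _+_ 0ℤ) (map-applyUpTo suc (λ j → coeffs (a ∷ q) j * d (suc k ℕ.∸ j)) (suc k)) ⟩
  foldr _+_ 0ℤ (applyUpTo (λ j → coeffs q j * d (k ℕ.∸ j)) (suc k))
    ≡⟨ cong (foldr _+_ 0ℤ) (sym (map-applyUpTo (λ j → j) (λ j → coeffs q j * d (k ℕ.∸ j)) (suc k))) ⟩
  polyMul (coeffs q) d k
    ≡⟨ polyMul≡act q d k ⟩
  act q d k ∎)
  where open ≡-Reasoning

shift-+ : ∀ e d d′ k → shift e (λ k → d k + d′ k) k ≡ shift e d k + shift e d′ k
shift-+ zero    d d′ k       = refl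
shift-+ (suc e) d d′ zero    = refl
shift-+ (suc e) d d′ (suc k) = shift-+ e d d′ k

act-cong : ∀ q {d d′} → (∀ k → d k ≡ d′ k) → ∀ k → act q d k ≡ act q d′ k
act-cong []      eq k = refl
act-cong (a ∷ q) eq k = cong₂ _+_ (cong (a *_) (eq k)) (shift-cong 1 (act-cong q eq) k)

act-shift : ∀ q d k → act q (shift 1 d) k ≡ shift 1 (act q d) k
act-shift []      d zero    = refl
act-shift []      d (suc k) = refl
act-shift (a ∷ q) d zero    = trans (ℤₚ.+-identityʳ _) (ℤₚ.*-zeroʳ a)
act-shift (a ∷ q) d (suc k) = cong (a * d k +_) (act-shift q d k)

act-+ : ∀ q d d′ k → act q (λ k → d k + d′ k) k ≡ act q d k + act q d′ k
act-+ []      d d′ k = refl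
act-+ (a ∷ q) d d′ k = begin
  a * (d k + d′ k) + shift 1 (act q (λ k → d k + d′ k)) k
    ≡⟨ cong₂ _+_ (ℤₚ.*-distribˡ-+ a (d k) (d′ k))
         (trans (shift-cong 1 (act-+ q d d′) k) (shift-+ 1 (act q d) (act q d′) k)) ⟩
  (a * d k + a * d′ k) + (shift 1 (act q d) k + shift 1 (act q d′) k)
    ≡⟨ interchange (a * d k) (a * d′ k) _ _ ⟩
  act (a ∷ q) d k + act (a ∷ q) d′ k ∎
  where open ≡-Reasoning

act-* : ∀ q c d k → act q (λ k → c * d k) k ≡ c * act q d k
act-* []      c d k = sym (ℤₚ.*-zeroʳ c)
act-* (a ∷ q) c d k = begin
  a * (c * d k) + shift 1 (act q (λ k → c * d k)) k
    ≡⟨ cong (a * (c * d k) +_) (trans (shift-cong 1 (act-* q c d) k) (shift-* 1 c (act q d) k)) ⟩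
  a * (c * d k) + c * shift 1 (act q d) k
    ≡⟨ lemma a c (d k) _ ⟩
  c * act (a ∷ q) d k ∎
  where
  open ≡-Reasoning
  lemma : ∀ a c x y → a * (c * x) + c * y ≡ c * (a * x + y)
  lemma = solve-∀

act-0 : ∀ q k → act q (λ _ → 0ℤ) k ≡ 0ℤ
act-0 []      k       = refl
act-0 (a ∷ q) zero    = trans (ℤₚ.+-identityʳ _) (ℤₚ.*-zeroʳ a)
act-0 (a ∷ q) (suc k) = trans (cong (_+ act q (λ _ → 0ℤ) k) (ℤₚ.*-zeroʳ a)) (trans (ℤₚ.+-identityˡ _) (act-0 q k))

-- Lets a divisibility survive multiplication of both sides by one polynomial, with the same
-- quotient.
act-comm : ∀ p q d k → act p (act q d) k ≡ act q (act p d) k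
act-comm []      q d k = sym (act-0 q k)
act-comm (a ∷ p) q d k = sym (begin
  act q (λ k → a * d k + shift 1 (act p d) k) k
    ≡⟨ act-+ q (λ k → a * d k) (shift 1 (act p d)) k ⟩
  act q (λ k → a * d k) k + act q (shift 1 (act p d)) k
    ≡⟨ cong₂ _+_ (act-* q a d k) (act-shift q (act p d) k) ⟩
  a * act q d k + shift 1 (act q (act p d)) k
    ≡⟨ cong (a * act q d k +_) (shift-cong 1 (λ k → sym (act-comm p q d k)) k) ⟩
  act (a ∷ p) (act q d) k ∎)
  where open ≡-Reasoning

_⊞_ : List ℤ → List ℤ → List ℤ
[]      ⊞ q       = q
(a ∷ p) ⊞ []      = a ∷ p
(a ∷ p) ⊞ (b ∷ q) = (a + b) ∷ (p ⊞ q)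

act-⊞ : ∀ p q d k → act (p ⊞ q) d k ≡ act p d k + act q d k
act-⊞ []      q       d k = sym (ℤₚ.+-identityˡ _)
act-⊞ (a ∷ p) []      d k = sym (ℤₚ.+-identityʳ _)
act-⊞ (a ∷ p) (b ∷ q) d k = begin
  (a + b) * d k + shift 1 (act (p ⊞ q) d) k
    ≡⟨ cong₂ _+_ (ℤₚ.*-distribʳ-+ (d k) a b)
         (trans (shift-cong 1 (act-⊞ p q d) k) (shift-+ 1 (act p d) (act q d) k)) ⟩
  (a * d k + b * d k) + (shift 1 (act p d) k + shift 1 (act q d) k)
    ≡⟨ interchange (a * d k) (b * d k) _ _ ⟩
  act (a ∷ p) d k + act (b ∷ q) d k ∎
  where open ≡-Reasoning

monomial : ℤ → ℕ → List ℤ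
monomial c zero    = c ∷ []
monomial c (suc e) = 0ℤ ∷ monomial c e

act-monomial : ∀ c e d k → act (monomial c e) d k ≡ c * shift e d k
act-monomial c zero    d zero    = ℤₚ.+-identityʳ _
act-monomial c zero    d (suc k) = ℤₚ.+-identityʳ _
act-monomial c (suc e) d zero    = sym (ℤₚ.*-zeroʳ c)
act-monomial c (suc e) d (suc k) = trans (ℤₚ.+-identityˡ _) (act-monomial c e d k)

polynomial : List I → (I → ℤ) → (I → ℕ) → List ℤ
polynomial xs c e = foldr (λ x → monomial (c x) (e x) ⊞_) [] xs

act-polynomial : ∀ (xs : List I) c e d k →
  act (polynomial xs c e) d k ≡ sumL xs (λ x → c x * shift (e x) d k)
act-polynomial []       c e d k = refl
act-polynomial (x ∷ xs) c e d k =
  trans (act-⊞ (monomial (c x) (e x)) _ d k)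
        (cong₂ _+_ (act-monomial (c x) (e x) d k) (act-polynomial xs c e d k))

-- Rank and closure

-- In the sum of the two hypotheses, a + d occurs on both sides.
+-chain : ∀ {a b c d e f} → a ℕ.+ b ≤ c ℕ.+ d → d ℕ.+ e ≤ a ℕ.+ f → e ℕ.+ b ≤ c ℕ.+ f
+-chain {a} {b} {c} {d} {e} {f} p q = ℕₚ.+-cancelˡ-≤ (a ℕ.+ d) (e ℕ.+ b) (c ℕ.+ f) (begin
  (a ℕ.+ d) ℕ.+ (e ℕ.+ b) ≡⟨ solve 4 (λ a b d e → (a :+ d) :+ (e :+ b) := (a :+ b) :+ (d :+ e)) refl a b d e ⟩
  (a ℕ.+ b) ℕ.+ (d ℕ.+ e) ≤⟨ ℕₚ.+-mono-≤ p q ⟩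
  (c ℕ.+ d) ℕ.+ (a ℕ.+ f) ≡⟨ solve 4 (λ a c d f → (c :+ d) :+ (a :+ f) := (a :+ d) :+ (c :+ f)) refl a c d f ⟩
  (a ℕ.+ d) ℕ.+ (c ℕ.+ f) ∎)
  where
  open ℕₚ.≤-Reasoning
  open +-*-Solver

∪-lub : A ⊆ C → B ⊆ C → A ∪ B ⊆ C
∪-lub {A = A} {B = B} f g x∈ = [ f , g ]′ (x∈p∪q⁻ A B x∈)

∪-⊆ˡ : A ⊆ A ∪ B
∪-⊆ˡ {A = A} {B = B} = p⊆p∪q B

∪-⊆ʳ : B ⊆ A ∪ B
∪-⊆ʳ {B = B} {A = A} = q⊆p∪q A B

∪-mono : A ⊆ X → B ⊆ Y → A ∪ B ⊆ X ∪ Y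
∪-mono f g = ∪-lub (λ x → ∪-⊆ˡ (f x)) (λ x → ∪-⊆ʳ (g x))

∩-⊆ˡ : A ∩ B ⊆ A
∩-⊆ˡ {A = A} {B = B} = p∩q⊆p A B

∩-⊆ʳ : A ∩ B ⊆ B
∩-⊆ʳ {A = A} {B = B} = p∩q⊆q A B

∩-glb : C ⊆ A → C ⊆ B → C ⊆ A ∩ B
∩-glb f g x = x∈p∩q⁺ (f x , g x)

⁅⁆-⊆ : ∀ {e : Fin n} → e ∈ A → ⁅ e ⁆ ⊆ A
⁅⁆-⊆ {A = A} {e = e} e∈A x∈ = subst (_∈ A) (sym (x∈⁅y⁆⇒x≡y e x∈)) e∈A

⊈⇒∃ : ¬ (A ⊆ B) → ∃[ e ] e ∈ A × e ∉ B
⊈⇒∃ {A = A} {B = B} A⊈B with any? (λ e → (e ∈? A) ×-dec ¬? (e ∈? B))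
... | yes p = p
... | no ¬p = ⊥-elim (A⊈B A⊆B)
  where
  A⊆B : A ⊆ B
  A⊆B {x} x∈A with x ∈? B
  ... | yes x∈B = x∈B
  ... | no x∉B  = ⊥-elim (¬p (x , x∈A , x∉B))

Disjoint : Subset n → Subset n → Set
Disjoint A B = ∀ {e} → e ∈ A → e ∉ B

Loopless : Matroid n → Set
Loopless M = ∀ e → e ∈ E M → r M ⁅ e ⁆ ≡ 1

module _ (M : Matroid n) where

  -- Submodularity merged with monotonicity: callers supply inclusions instead of computing unions
  -- and intersections.
  submod : A ⊆ E M → B ⊆ E M → X ⊆ A ∪ B → Y ⊆ A → Y ⊆ B → r M X ℕ.+ r M Y ≤ r M A ℕ.+ r M B
  submod {A = A} {B = B} {X = X} {Y = Y} A⊆E B⊆E X⊆ Y⊆A Y⊆B = ℕₚ.≤-trans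
    (ℕₚ.+-mono-≤ (r-mono M X (A ∪ B) X⊆ (∪-lub A⊆E B⊆E)) (r-mono M Y (A ∩ B) (∩-glb Y⊆A Y⊆B) (λ x → A⊆E (∩-⊆ˡ x))))
    (r-submod M A B A⊆E B⊆E)

  mono : X ⊆ Y → Y ⊆ E M → r M X ≤ r M Y
  mono {X = X} {Y = Y} = r-mono M X Y

  r-∅ : r M ∅ ≡ 0
  r-∅ = ℕₚ.n≤0⇒n≡0 (ℕₚ.≤-trans (r-bound M ∅ (⊆-min (E M))) (ℕₚ.≤-reflexive (∣⊥∣≡0 n)))

  r-∪ : A ⊆ E M → B ⊆ E M → r M (A ∪ B) ≤ r M A ℕ.+ r M B
  r-∪ {A = A} {B = B} A⊆E B⊆E = subst (_≤ r M A ℕ.+ r M B) (trans (cong (r M (A ∪ B) ℕ.+_) r-∅) (ℕₚ.+-identityʳ _))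
    (submod {X = A ∪ B} {Y = ∅} A⊆E B⊆E (λ x → x) (⊆-min A) (⊆-min B))

  -- Elements of Y are added to X one by one. Submodularity of W and X ∪ ⁅ e ⁆, which share X, keeps
  -- the rank at most r(X).
  span : X ⊆ Y → Y ⊆ E M → (∀ {e} → e ∈ Y → r M (X ∪ ⁅ e ⁆) ≤ r M X) → r M Y ≤ r M X
  span {X = X} {Y = Y} X⊆Y Y⊆E dep = grow ∣ Y ∣ X (λ x → x) X⊆Y ℕₚ.≤-refl (ℕₚ.m≤n+m ∣ Y ∣ ∣ X ∣)
    where
    -- `k` bounds the number of elements of Y still missing from `W`.
    grow : ∀ k W → X ⊆ W → W ⊆ Y → r M W ≤ r M X → ∣ Y ∣ ≤ ∣ W ∣ ℕ.+ k → r M Y ≤ r M X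
    grow k W X⊆W W⊆Y rW bound with Y ⊆? W
    ... | yes Y⊆W = ℕₚ.≤-trans (mono Y⊆W (λ x → Y⊆E (W⊆Y x))) rW
    ... | no Y⊈W with ⊈⇒∃ Y⊈W
    ... | e , e∈Y , e∉W with k
    ... | zero = ⊥-elim (ℕₚ.<-irrefl refl (ℕₚ.<-≤-trans (p⊂q⇒∣p∣<∣q∣ (W⊆Y , e , e∈Y , e∉W))
                   (ℕₚ.≤-trans bound (ℕₚ.≤-reflexive (ℕₚ.+-identityʳ ∣ W ∣)))))
    ... | suc k′ = grow k′ (W ∪ ⁅ e ⁆) (λ x → ∪-⊆ˡ (X⊆W x)) (∪-lub W⊆Y (⁅⁆-⊆ e∈Y))
      (ℕₚ.+-cancelʳ-≤ (r M X) _ _ (ℕₚ.≤-trans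
        (submod {A = W} {B = X ∪ ⁅ e ⁆} {X = W ∪ ⁅ e ⁆} {Y = X}
          (λ x → Y⊆E (W⊆Y x)) (∪-lub (λ x → Y⊆E (X⊆Y x)) (⁅⁆-⊆ (Y⊆E e∈Y))) (∪-mono (λ x → x) ∪-⊆ʳ) X⊆W ∪-⊆ˡ)
        (ℕₚ.+-mono-≤ rW (dep e∈Y))))
      (begin
        ∣ Y ∣                       ≤⟨ bound ⟩
        ∣ W ∣ ℕ.+ suc k′            ≡⟨ ℕₚ.+-suc ∣ W ∣ k′ ⟩
        suc ∣ W ∣ ℕ.+ k′            ≤⟨ ℕₚ.+-monoˡ-≤ k′ (p⊂q⇒∣p∣<∣q∣ (∪-⊆ˡ , e , ∪-⊆ʳ (x∈⁅x⁆ e) , e∉W)) ⟩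
        ∣ W ∪ ⁅ e ⁆ ∣ ℕ.+ k′        ∎)
      where open ℕₚ.≤-Reasoning

  ∈cl⁺ : ∀ {e} → X ⊆ E M → e ∈ E M → r M (X ∪ ⁅ e ⁆) ≤ r M X → e ∈ cl M X
  ∈cl⁺ {X = X} {e = e} X⊆E e∈E le = Vecₚ.lookup⇒[]= e (cl M X) (trans (Vecₚ.lookup∘tabulate _ e) both)
    where
    both : ⌊ e ∈? E M ⌋ ∧ ⌊ r M (X ∪ ⁅ e ⁆) ℕ.≟ r M X ⌋ ≡ true
    both with e ∈? E M | r M (X ∪ ⁅ e ⁆) ℕ.≟ r M X
    ... | yes _ | yes _ = refl
    ... | yes _ | no ≢  = ⊥-elim (≢ (ℕₚ.≤-antisym le (mono ∪-⊆ˡ (∪-lub X⊆E (⁅⁆-⊆ e∈E)))))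
    ... | no ∉  | _     = ⊥-elim (∉ e∈E)

  ∈cl⁻ : ∀ {e} → e ∈ cl M X → e ∈ E M × r M (X ∪ ⁅ e ⁆) ≡ r M X
  ∈cl⁻ {X = X} {e = e} e∈ = both (trans (sym (Vecₚ.lookup∘tabulate _ e)) (Vecₚ.[]=⇒lookup e∈))
    where
    both : ⌊ e ∈? E M ⌋ ∧ ⌊ r M (X ∪ ⁅ e ⁆) ℕ.≟ r M X ⌋ ≡ true → e ∈ E M × r M (X ∪ ⁅ e ⁆) ≡ r M X
    both eq with e ∈? E M | r M (X ∪ ⁅ e ⁆) ℕ.≟ r M X
    both eq | yes e∈E | yes req = e∈E , req
    both () | yes _   | no _
    both () | no _    | _

  flat-⊆E : IsFlat M X → X ⊆ E M
  flat-⊆E {X = X} fl x∈ = proj₁ (∈cl⁻ {X = X} (subst (_ ∈_) (sym fl) x∈))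

  flat-∈ : ∀ {e} → IsFlat M X → e ∈ E M → r M (X ∪ ⁅ e ⁆) ≤ r M X → e ∈ X
  flat-∈ {X = X} fl e∈E le = subst (_ ∈_) fl (∈cl⁺ (flat-⊆E fl) e∈E le)

  mkFlat : X ⊆ E M → (∀ {e} → e ∈ E M → r M (X ∪ ⁅ e ⁆) ≤ r M X → e ∈ X) → IsFlat M X
  mkFlat {X = X} X⊆E closed = ⊆-antisym
    (λ e∈ → let e∈E , eq = ∈cl⁻ {X = X} e∈ in closed e∈E (ℕₚ.≤-reflexive eq))
    (λ e∈X → ∈cl⁺ X⊆E (X⊆E e∈X) (mono (∪-lub (λ x → x) (⁅⁆-⊆ e∈X)) X⊆E))

  cl-⊆E : cl M X ⊆ E M
  cl-⊆E {X = X} e∈ = proj₁ (∈cl⁻ {X = X} e∈)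

  ⊆-cl : X ⊆ E M → X ⊆ cl M X
  ⊆-cl X⊆E e∈X = ∈cl⁺ X⊆E (X⊆E e∈X) (mono (∪-lub (λ x → x) (⁅⁆-⊆ e∈X)) X⊆E)

  r-cl : X ⊆ E M → r M (cl M X) ≡ r M X
  r-cl {X = X} X⊆E = ℕₚ.≤-antisym
    (span (⊆-cl X⊆E) (cl-⊆E {X = X}) (λ e∈ → ℕₚ.≤-reflexive (proj₂ (∈cl⁻ {X = X} e∈))))
    (mono (⊆-cl X⊆E) (cl-⊆E {X = X}))

  cl-flat : X ⊆ E M → IsFlat M (cl M X)
  cl-flat {X = X} X⊆E = mkFlat (cl-⊆E {X = X}) (λ {e} e∈E le → ∈cl⁺ X⊆E e∈E (begin
    r M (X ∪ ⁅ e ⁆)      ≤⟨ mono (∪-mono (⊆-cl X⊆E) (λ x → x)) (∪-lub (cl-⊆E {X = X}) (⁅⁆-⊆ e∈E)) ⟩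
    r M (cl M X ∪ ⁅ e ⁆) ≤⟨ le ⟩
    r M (cl M X)         ≡⟨ r-cl X⊆E ⟩
    r M X ∎))
    where open ℕₚ.≤-Reasoning

  -- By its rank, Y is spanned by X ∩ Y, hence by X, and X is closed. Inclusions between flats are
  -- reduced to rank estimates in this way.
  flat-max : IsFlat M X → Y ⊆ E M → r M Y ≤ r M (X ∩ Y) → Y ⊆ X
  flat-max {X = X} {Y = Y} fl Y⊆E le {e} e∈Y = flat-∈ fl (Y⊆E e∈Y)
    (ℕₚ.+-cancelʳ-≤ (r M (X ∩ Y)) _ _ (ℕₚ.≤-trans
      (submod {A = X} {B = Y} {X = X ∪ ⁅ e ⁆} {Y = X ∩ Y} (flat-⊆E fl) Y⊆E (∪-mono (λ x → x) (⁅⁆-⊆ e∈Y)) ∩-⊆ˡ ∩-⊆ʳ)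
      (ℕₚ.+-monoʳ-≤ (r M X) le)))

  flat-≤ : IsFlat M X → X ⊆ Y → Y ⊆ E M → r M Y ≤ r M X → X ≡ Y
  flat-≤ fl X⊆Y Y⊆E le = ⊆-antisym X⊆Y
    (flat-max fl Y⊆E (ℕₚ.≤-trans le (mono (∩-glb (λ x → x) X⊆Y) (λ x → Y⊆E (∩-⊆ʳ x)))))

  cl-least : IsFlat M Y → X ⊆ Y → cl M X ⊆ Y
  cl-least {Y = Y} {X = X} fl X⊆Y = flat-max fl (cl-⊆E {X = X})
    (ℕₚ.≤-trans (ℕₚ.≤-reflexive (r-cl X⊆E)) (mono (∩-glb X⊆Y (⊆-cl X⊆E)) (λ x → flat-⊆E fl (∩-⊆ˡ x))))
    where
    X⊆E : X ⊆ E M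
    X⊆E x = flat-⊆E fl (X⊆Y x)

  cl-mono : X ⊆ Y → Y ⊆ E M → cl M X ⊆ cl M Y
  cl-mono X⊆Y Y⊆E = cl-least (cl-flat Y⊆E) (λ x → ⊆-cl Y⊆E (X⊆Y x))

  flat-∩ : IsFlat M X → IsFlat M Y → IsFlat M (X ∩ Y)
  flat-∩ {X = X} {Y = Y} fX fY = mkFlat X∩Y⊆E (λ e∈E le → ∩-glb′ (below fX ∩-⊆ˡ e∈E le) (below fY ∩-⊆ʳ e∈E le))
    where
    X∩Y⊆E : X ∩ Y ⊆ E M
    X∩Y⊆E x = flat-⊆E fX (∩-⊆ˡ x)
    ∩-glb′ : ∀ {e} → e ∈ X → e ∈ Y → e ∈ X ∩ Y
    ∩-glb′ a b = x∈p∩q⁺ (a , b)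
    below : ∀ {F e} → IsFlat M F → X ∩ Y ⊆ F → e ∈ E M → r M ((X ∩ Y) ∪ ⁅ e ⁆) ≤ r M (X ∩ Y) → e ∈ F
    below fF sub e∈E le = cl-least fF sub (∈cl⁺ X∩Y⊆E e∈E le)

  ∅-flat : Loopless M → IsFlat M ∅
  ∅-flat ll = mkFlat (⊆-min (E M)) (λ {e} e∈E le → ⊥-elim (ℕₚ.<-irrefl refl (begin-strict
    0             <⟨ s≤s z≤n ⟩
    1             ≡⟨ sym (ll e e∈E) ⟩
    r M ⁅ e ⁆     ≤⟨ mono ∪-⊆ʳ (∪-lub (⊆-min (E M)) (⁅⁆-⊆ e∈E)) ⟩
    r M (∅ ∪ ⁅ e ⁆) ≤⟨ le ⟩
    r M ∅         ≡⟨ r-∅ ⟩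
    0             ∎)))
    where open ℕₚ.≤-Reasoning

  r≡0⇒Disjoint : Loopless M → A ⊆ E M → r M (A ∩ B) ≡ 0 → Disjoint A B
  r≡0⇒Disjoint {A = A} {B = B} ll A⊆E eq {e} e∈A e∈B = ℕₚ.<-irrefl refl (begin-strict
    0           <⟨ s≤s z≤n ⟩
    1           ≡⟨ sym (ll e (A⊆E e∈A)) ⟩
    r M ⁅ e ⁆   ≤⟨ mono (⁅⁆-⊆ (x∈p∩q⁺ (e∈A , e∈B))) (λ x → A⊆E (∩-⊆ˡ x)) ⟩
    r M (A ∩ B) ≡⟨ eq ⟩
    0           ∎)
    where open ℕₚ.≤-Reasoning

  Disjoint⇒r≡0 : Disjoint A B → r M (A ∩ B) ≡ 0
  Disjoint⇒r≡0 {A = A} {B = B} dis = trans (cong (r M) (Empty-unique ¬∈)) r-∅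
    where
    ¬∈ : Empty (A ∩ B)
    ¬∈ (e , e∈) = dis (∩-⊆ˡ e∈) (∩-⊆ʳ e∈)

  -- For flats the join X ∨ Y has the rank of X ∪ Y, and the reverse inequality is submodularity.
  Modular : Subset n → Set
  Modular X = IsFlat M X × (∀ Y → IsFlat M Y → r M X ℕ.+ r M Y ≤ r M (X ∩ Y) ℕ.+ r M (X ∪ Y))

  IsModularFlat⇒Modular : IsModularFlat M X → Modular X
  IsModularFlat⇒Modular {X = X} (fX , md) = fX , λ Y fY → ℕₚ.≤-reflexive
    (trans (md Y fY) (cong (r M (X ∩ Y) ℕ.+_) (r-cl (∪-lub (flat-⊆E fX) (flat-⊆E fY)))))

  -- Roundness of the flat X in terms of flats of the ambient matroid, and as a disjunction, so that
  -- it directly yields a case distinction.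
  RoundIn : Subset n → Set
  RoundIn X = ∀ A B → IsFlat M A → IsFlat M B → X ⊆ A ∪ B → X ⊆ A ⊎ X ⊆ B

  -- Stated by ranks, so that a point `⁅ h ⁆` or a union can be used without taking closures. The
  -- second part says that C and X together span E.
  Complement : Subset n → Subset n → Set
  Complement X C = r M C ℕ.+ r M X ≡ rank M × rank M ≤ r M (C ∪ X)

  -- Submodularity leaves rank 0 for C ∩ X, and without loops only the empty set has rank 0.
  complement⇒disjoint : Loopless M → C ⊆ E M → X ⊆ E M → Complement X C → Disjoint C X
  complement⇒disjoint {C = C} {X = X} ll C⊆E X⊆E (eq , le) = r≡0⇒Disjoint ll C⊆E
    (ℕₚ.n≤0⇒n≡0 (ℕₚ.+-cancelˡ-≤ (rank M) _ _ (begin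
      rank M ℕ.+ r M (C ∩ X)        ≤⟨ ℕₚ.+-monoˡ-≤ (r M (C ∩ X)) le ⟩
      r M (C ∪ X) ℕ.+ r M (C ∩ X)   ≤⟨ r-submod M C X C⊆E X⊆E ⟩
      r M C ℕ.+ r M X               ≡⟨ eq ⟩
      rank M                        ≡⟨ sym (ℕₚ.+-identityʳ _) ⟩
      rank M ℕ.+ 0 ∎)))
    where open ℕₚ.≤-Reasoning

-- Restriction to a flat

module _ (M : Matroid n) {Z : Subset n} (Z⊆E : Z ⊆ E M) where

  flat-restrict⁺ : IsFlat M X → X ⊆ Z → IsFlat ((M ∣ Z) Z⊆E) X
  flat-restrict⁺ fX X⊆Z = mkFlat ((M ∣ Z) Z⊆E) X⊆Z (λ e∈Z le → flat-∈ M fX (Z⊆E e∈Z) le)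

  flat-restrict⁻ : IsFlat M Z → IsFlat ((M ∣ Z) Z⊆E) X → IsFlat M X
  flat-restrict⁻ {X = X} fZ fX = mkFlat M X⊆E
    (λ e∈E le → flat-∈ ((M ∣ Z) Z⊆E) fX (cl-least M fZ (flat-⊆E ((M ∣ Z) Z⊆E) fX) (∈cl⁺ M X⊆E e∈E le)) le)
    where
    X⊆E : X ⊆ E M
    X⊆E x = Z⊆E (flat-⊆E ((M ∣ Z) Z⊆E) fX x)

  RoundIn-restrict : IsFlat M Z → RoundIn M X → RoundIn ((M ∣ Z) Z⊆E) X
  RoundIn-restrict fZ rd A B fA fB = rd A B (flat-restrict⁻ fZ fA) (flat-restrict⁻ fZ fB)

  -- If Z lay in neither A nor B, the traces Z ∩ A and Z ∩ B would be proper flats of M|Z that cover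
  -- Z.
  Round⇒RoundIn : IsFlat M Z → Round ((M ∣ Z) Z⊆E) → RoundIn M Z
  Round⇒RoundIn fZ rd A B fA fB Z⊆A∪B with Z ⊆? A | Z ⊆? B
  ... | yes p | _     = inj₁ p
  ... | no _  | yes q = inj₂ q
  ... | no ¬p | no ¬q = ⊥-elim (rd (Z ∩ A , Z ∩ B , proper fA ¬p , proper fB ¬q , ⊆-antisym
      (λ x → [ (λ a → ∪-⊆ˡ (x∈p∩q⁺ (x , a))) , (λ b → ∪-⊆ʳ (x∈p∩q⁺ (x , b))) ]′ (x∈p∪q⁻ A B (Z⊆A∪B x)))
      (∪-lub ∩-⊆ˡ ∩-⊆ˡ)))
    where
    proper : ∀ {F} → IsFlat M F → ¬ (Z ⊆ F) → IsProperFlat ((M ∣ Z) Z⊆E) (Z ∩ F)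
    proper fF Z⊈F = flat-restrict⁺ (flat-∩ M fZ fF) ∩-⊆ˡ ,
                    λ eq → Z⊈F (λ x → ∩-⊆ʳ (subst (_ ∈_) (sym eq) x))

  -- For a flat Y ⊆ Z, modularity of X at Y is combined with submodularity of X and (X ∩ Z) ∪ Y,
  -- whose intersection contains X ∩ Z; the ranks of X and X ∪ Y drop out.
  Modular-∩ : IsFlat M Z → Modular M X → Modular ((M ∣ Z) Z⊆E) (X ∩ Z)
  Modular-∩ {X = X} fZ (fX , md) = flat-restrict⁺ (flat-∩ M fX fZ) ∩-⊆ʳ , λ Y fY →
    let Y⊆Z = flat-⊆E ((M ∣ Z) Z⊆E) fY
        fY′ = flat-restrict⁻ fZ fY
    in ℕₚ.≤-trans
      (+-chain {c = r M (X ∩ Y)} (md Y fY′)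
        (submod M {A = X} {B = (X ∩ Z) ∪ Y} {X = X ∪ Y} {Y = X ∩ Z}
          (flat-⊆E M fX) (∪-lub (λ x → Z⊆E (∩-⊆ʳ x)) (flat-⊆E M fY′)) (∪-mono (λ x → x) ∪-⊆ʳ) ∩-⊆ˡ ∪-⊆ˡ))
      (ℕₚ.+-monoˡ-≤ (r M ((X ∩ Z) ∪ Y))
        (mono M (∩-glb (∩-glb ∩-⊆ˡ (λ x → Y⊆Z (∩-⊆ʳ x))) ∩-⊆ʳ) (λ x → flat-⊆E M fY′ (∩-⊆ʳ x))))

-- Complements of a modular flat

-- F ↦ C ∨ F is an isomorphism from [∅, Z] to [C, E] with inverse G ↦ G ∩ Z.

module _ (M : Matroid n) {Z C : Subset n} (Z-mod : Modular M Z) (Z⊆E : Z ⊆ E M) (C⊆E : C ⊆ E M) (compl : Complement M Z C) where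

  private
    C∪⊆E : X ⊆ Z → C ∪ X ⊆ E M
    C∪⊆E X⊆Z = ∪-lub C⊆E (λ x → Z⊆E (X⊆Z x))
    open ℕₚ.≤-Reasoning

  -- A loss of rank in C ∪ X would persist after adding the rest of Z, contrary to r(C ∪ Z) = r(C) +
  -- r(Z).
  compl-r : X ⊆ Z → r M (C ∪ X) ≡ r M C ℕ.+ r M X
  compl-r {X = X} X⊆Z = ℕₚ.≤-antisym (r-∪ M C⊆E (λ x → Z⊆E (X⊆Z x))) (ℕₚ.+-cancelʳ-≤ (r M Z) _ _ (begin
    r M C ℕ.+ r M X ℕ.+ r M Z     ≡⟨ solve 3 (λ a b c → a :+ b :+ c := (a :+ c) :+ b) refl (r M C) (r M X) (r M Z) ⟩
    (r M C ℕ.+ r M Z) ℕ.+ r M X   ≤⟨ ℕₚ.+-monoˡ-≤ (r M X) (ℕₚ.≤-trans (ℕₚ.≤-reflexive (proj₁ compl)) (proj₂ compl)) ⟩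
    r M (C ∪ Z) ℕ.+ r M X         ≤⟨ submod M (C∪⊆E X⊆Z) Z⊆E (∪-mono ∪-⊆ˡ (λ x → x)) ∪-⊆ʳ X⊆Z ⟩
    r M (C ∪ X) ℕ.+ r M Z ∎))
    where open +-*-Solver

  -- C ∨ X and Z together span E, so submodularity bounds the rank of their intersection by r(X);
  -- the flat X inside it then fills it.
  compl-∩ : IsFlat M X → X ⊆ Z → cl M (C ∪ X) ∩ Z ≡ X
  compl-∩ {X = X} fX X⊆Z = sym (flat-≤ M fX (∩-glb (λ x → ⊆-cl M (C∪⊆E X⊆Z) (∪-⊆ʳ x)) X⊆Z) (λ x → Z⊆E (∩-⊆ʳ x))
    (ℕₚ.+-cancelˡ-≤ (rank M) _ _ (begin
      rank M ℕ.+ r M (cl M (C ∪ X) ∩ Z)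
        ≤⟨ ℕₚ.+-monoˡ-≤ _ (proj₂ compl) ⟩
      r M (C ∪ Z) ℕ.+ r M (cl M (C ∪ X) ∩ Z)
        ≤⟨ submod M (cl-⊆E M {X = C ∪ X}) Z⊆E (∪-mono (λ x → ⊆-cl M (C∪⊆E X⊆Z) (∪-⊆ˡ x)) (λ x → x)) ∩-⊆ˡ ∩-⊆ʳ ⟩
      r M (cl M (C ∪ X)) ℕ.+ r M Z
        ≡⟨ cong (ℕ._+ r M Z) (trans (r-cl M (C∪⊆E X⊆Z)) (compl-r X⊆Z)) ⟩
      r M C ℕ.+ r M X ℕ.+ r M Z
        ≡⟨ solve 3 (λ a b c → a :+ b :+ c := (a :+ c) :+ b) refl (r M C) (r M X) (r M Z) ⟩
      (r M C ℕ.+ r M Z) ℕ.+ r M X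
        ≡⟨ cong (ℕ._+ r M X) (proj₁ compl) ⟩
      rank M ℕ.+ r M X ∎)))
    where open +-*-Solver

  -- Here modularity of Z enters: it gives r(Y ∩ Z) ≥ r(Y) + r(Z) - r(E) = r(Y) - r(C), so C ∨ (Y ∩
  -- Z) already has the rank of Y.
  compl-cl : IsFlat M Y → C ⊆ Y → cl M (C ∪ (Y ∩ Z)) ≡ Y
  compl-cl {Y = Y} fY C⊆Y = flat-≤ M (cl-flat M (C∪⊆E ∩-⊆ʳ)) (cl-least M fY (∪-lub C⊆Y ∩-⊆ˡ)) Y⊆E
    (ℕₚ.+-cancelˡ-≤ (r M Z) _ _ (begin
      r M Z ℕ.+ r M Y
        ≤⟨ proj₂ Z-mod Y fY ⟩
      r M (Z ∩ Y) ℕ.+ r M (Z ∪ Y)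
        ≤⟨ ℕₚ.+-mono-≤ (mono M (∩-glb ∩-⊆ʳ ∩-⊆ˡ) (λ x → Y⊆E (∩-⊆ˡ x))) (mono M (∪-lub Z⊆E Y⊆E) (λ x → x)) ⟩
      r M (Y ∩ Z) ℕ.+ rank M
        ≡⟨ cong (r M (Y ∩ Z) ℕ.+_) (sym (proj₁ compl)) ⟩
      r M (Y ∩ Z) ℕ.+ (r M C ℕ.+ r M Z)
        ≡⟨ solve 3 (λ a b c → a :+ (b :+ c) := c :+ (b :+ a)) refl (r M (Y ∩ Z)) (r M C) (r M Z) ⟩
      r M Z ℕ.+ (r M C ℕ.+ r M (Y ∩ Z))
        ≡⟨ cong (r M Z ℕ.+_) (sym (trans (r-cl M (C∪⊆E ∩-⊆ʳ)) (compl-r ∩-⊆ʳ))) ⟩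
      r M Z ℕ.+ r M (cl M (C ∪ (Y ∩ Z))) ∎))
    where
    open +-*-Solver
    Y⊆E : Y ⊆ E M
    Y⊆E = flat-⊆E M fY

  -- The image in [∅, Z] of X / C.
  project : Subset n → Subset n
  project X = cl M (X ∪ C) ∩ Z

  module _ {X : Subset n} (X⊆E : X ⊆ E M) where

    private
      X∪C⊆E : X ∪ C ⊆ E M
      X∪C⊆E = ∪-lub X⊆E C⊆E

    cl-project : cl M (C ∪ project X) ≡ cl M (X ∪ C)
    cl-project = compl-cl (cl-flat M X∪C⊆E) (λ x → ⊆-cl M X∪C⊆E (∪-⊆ʳ x))

    r-project : r M C ℕ.+ r M (project X) ≡ r M (X ∪ C)
    r-project = trans (sym (compl-r ∩-⊆ʳ)) (trans (sym (r-cl M (C∪⊆E ∩-⊆ʳ))) (trans (cong (r M) cl-project) (r-cl M X∪C⊆E)))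

    project-flat : IsFlat M (project X)
    project-flat = flat-∩ M (cl-flat M X∪C⊆E) (proj₁ Z-mod)

    ⊆-cl-project : X ⊆ cl M (C ∪ project X)
    ⊆-cl-project x = subst (_ ∈_) (sym cl-project) (⊆-cl M X∪C⊆E (∪-⊆ˡ x))

  -- For a flat Y ⊆ Z put G = C ∨ Y and T = X ∩ G. Modularity of X at G gives `high`. Contracting C
  -- cannot enlarge the rank difference between T and X, and the image of T lies in X′ ∩ Y; this
  -- gives `low`. In the sum of both, r(X) and r(T) drop out.
  project-Modular : Modular M X → Modular ((M ∣ Z) Z⊆E) (project X)
  project-Modular {X = X} (fX , md) = flat-restrict⁺ M Z⊆E (project-flat (flat-⊆E M fX)) ∩-⊆ʳ , λ Y fY →
    let c     = r M C
        X⊆E   = flat-⊆E M fX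
        Y⊆Z   = flat-⊆E ((M ∣ Z) Z⊆E) fY
        fY′   = flat-restrict⁻ M Z⊆E (proj₁ Z-mod) fY
        G     = cl M (C ∪ Y)
        fG    = cl-flat M (C∪⊆E Y⊆Z)
        C⊆G   = λ {x} (x∈ : x ∈ C) → ⊆-cl M (C∪⊆E Y⊆Z) (∪-⊆ˡ x∈)
        T     = X ∩ G
        T⊆E   = λ {x} (x∈ : x ∈ T) → X⊆E (∩-⊆ˡ x∈)
        X∪C⊆E = ∪-lub X⊆E C⊆E
        X′    = project X
        X′∪Y⊆Z = ∪-lub ∩-⊆ʳ Y⊆Z
        T′⊆ : project T ⊆ X′ ∩ Y
        T′⊆ = ∩-glb (∩-glb (λ x → cl-mono M (∪-mono ∩-⊆ˡ (λ x → x)) X∪C⊆E (∩-⊆ˡ x)) ∩-⊆ʳ)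
                (λ x → subst (_ ∈_) (compl-∩ fY′ Y⊆Z)
                  (x∈p∩q⁺ (cl-least M fG (∪-lub ∩-⊆ʳ C⊆G) (∩-⊆ˡ x) , ∩-⊆ʳ x)))
        low : r M X′ ℕ.+ r M T ≤ r M X ℕ.+ r M (X′ ∩ Y)
        low = ℕₚ.+-cancelˡ-≤ c _ _ (begin
          c ℕ.+ (r M X′ ℕ.+ r M T)        ≡⟨ sym (ℕₚ.+-assoc c _ _) ⟩
          c ℕ.+ r M X′ ℕ.+ r M T          ≡⟨ cong (ℕ._+ r M T) (r-project X⊆E) ⟩
          r M (X ∪ C) ℕ.+ r M T           ≤⟨ submod M X⊆E (∪-lub T⊆E C⊆E) (∪-mono (λ x → x) ∪-⊆ʳ) ∩-⊆ˡ ∪-⊆ˡ ⟩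
          r M X ℕ.+ r M (T ∪ C)           ≡⟨ cong (r M X ℕ.+_) (sym (r-project T⊆E)) ⟩
          r M X ℕ.+ (c ℕ.+ r M (project T)) ≤⟨ ℕₚ.+-monoʳ-≤ (r M X) (ℕₚ.+-monoʳ-≤ c (mono M T′⊆ (λ x → Z⊆E (Y⊆Z (∩-⊆ʳ x))))) ⟩
          r M X ℕ.+ (c ℕ.+ r M (X′ ∩ Y))  ≡⟨ solve 3 (λ x c y → x :+ (c :+ y) := c :+ (x :+ y)) refl (r M X) c (r M (X′ ∩ Y)) ⟩
          c ℕ.+ (r M X ℕ.+ r M (X′ ∩ Y))  ∎)
        top : X ∪ G ⊆ cl M (C ∪ (X′ ∪ Y))
        top = ∪-lub (λ x → cl-mono M (∪-mono (λ x → x) ∪-⊆ˡ) (C∪⊆E X′∪Y⊆Z) (⊆-cl-project X⊆E x))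
                    (cl-mono M (∪-mono (λ x → x) ∪-⊆ʳ) (C∪⊆E X′∪Y⊆Z))
        high : r M X ℕ.+ r M Y ≤ r M (X′ ∪ Y) ℕ.+ r M T
        high = ℕₚ.+-cancelˡ-≤ c _ _ (begin
          c ℕ.+ (r M X ℕ.+ r M Y)        ≡⟨ solve 3 (λ x c y → c :+ (x :+ y) := x :+ (c :+ y)) refl (r M X) c (r M Y) ⟩
          r M X ℕ.+ (c ℕ.+ r M Y)        ≡⟨ cong (r M X ℕ.+_) (sym (trans (r-cl M (C∪⊆E Y⊆Z)) (compl-r Y⊆Z))) ⟩
          r M X ℕ.+ r M G                ≤⟨ md G fG ⟩
          r M T ℕ.+ r M (X ∪ G)          ≤⟨ ℕₚ.+-monoʳ-≤ (r M T) (mono M top (cl-⊆E M {X = C ∪ (X′ ∪ Y)})) ⟩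
          r M T ℕ.+ r M (cl M (C ∪ (X′ ∪ Y)))
            ≡⟨ cong (r M T ℕ.+_) (trans (r-cl M (C∪⊆E X′∪Y⊆Z)) (compl-r X′∪Y⊆Z)) ⟩
          r M T ℕ.+ (c ℕ.+ r M (X′ ∪ Y)) ≡⟨ solve 3 (λ x c y → x :+ (c :+ y) := c :+ (y :+ x)) refl (r M T) c (r M (X′ ∪ Y)) ⟩
          c ℕ.+ (r M (X′ ∪ Y) ℕ.+ r M T) ∎)
    in ℕₚ.≤-trans
         (+-chain {a = r M X} {b = r M Y} {c = r M (X′ ∪ Y)} {d = r M T} {e = r M X′} high
           (ℕₚ.≤-trans (ℕₚ.≤-reflexive (ℕₚ.+-comm (r M T) _)) low))
         (ℕₚ.≤-reflexive (ℕₚ.+-comm (r M (X′ ∪ Y)) _))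
    where open +-*-Solver

  -- Each x ∈ X lies on a flat C ∨ p with p ∈ project X, so a cover of project X by two flats lifts to one of X.
  project-RoundIn : Loopless M → IsFlat M X → RoundIn M X → RoundIn ((M ∣ Z) Z⊆E) (project X)
  project-RoundIn {X = X} ll fX rd A B fA fB X′⊆A∪B
    = [ inA , inB ]′
      (rd (cl M (C ∪ A)) (cl M (C ∪ B)) (cl-flat M (C∪⊆E (flat-⊆E ((M ∣ Z) Z⊆E) fA)))
            (cl-flat M (C∪⊆E (flat-⊆E ((M ∣ Z) Z⊆E) fB))) lift)
    where
    X⊆E : X ⊆ E M
    X⊆E = flat-⊆E M fX
    ⊆Z : IsFlat ((M ∣ Z) Z⊆E) Y → Y ⊆ Z
    ⊆Z = flat-⊆E ((M ∣ Z) Z⊆E)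
    flat : IsFlat ((M ∣ Z) Z⊆E) Y → IsFlat M Y
    flat = flat-restrict⁻ M Z⊆E (proj₁ Z-mod)
    descend : ∀ Y → IsFlat ((M ∣ Z) Z⊆E) Y → X ⊆ cl M (C ∪ Y) → project X ⊆ Y
    descend Y fY X⊆ x = subst (_ ∈_) (compl-∩ (flat fY) (⊆Z fY))
      (x∈p∩q⁺ (cl-least M (cl-flat M (C∪⊆E (⊆Z fY))) (∪-lub X⊆ (λ x → ⊆-cl M (C∪⊆E (⊆Z fY)) (∪-⊆ˡ x))) (∩-⊆ˡ x) , ∩-⊆ʳ x))
    inA : X ⊆ cl M (C ∪ A) → project X ⊆ A ⊎ project X ⊆ B
    inA X⊆ = inj₁ (descend A fA X⊆)
    inB : X ⊆ cl M (C ∪ B) → project X ⊆ A ⊎ project X ⊆ B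
    inB X⊆ = inj₂ (descend B fB X⊆)
    lift : X ⊆ cl M (C ∪ A) ∪ cl M (C ∪ B)
    lift {x} x∈X with project ⁅ x ⁆ ⊆? A
    ... | yes D⊆A = ∪-⊆ˡ (cl-mono M (∪-mono (λ x → x) D⊆A) (C∪⊆E (⊆Z fA)) (⊆-cl-project (⁅⁆-⊆ (X⊆E x∈X)) (x∈⁅x⁆ x)))
    ... | no D⊈A with ⊈⇒∃ D⊈A
    ... | p , p∈D , p∉A = ∪-⊆ʳ (cl-mono M (∪-mono (λ x → x) D⊆B) (C∪⊆E (⊆Z fB)) (⊆-cl-project (⁅⁆-⊆ (X⊆E x∈X)) (x∈⁅x⁆ x)))
      where
      D : Subset n
      D = project ⁅ x ⁆
      D⊆E : D ⊆ E M
      D⊆E y = Z⊆E (∩-⊆ʳ y)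
      p∈B : p ∈ B
      p∈B = [ (λ p∈A → ⊥-elim (p∉A p∈A)) , (λ b → b) ]′ (x∈p∪q⁻ A B (X′⊆A∪B
        (∩-glb (λ y → cl-mono M (∪-mono (⁅⁆-⊆ x∈X) (λ x → x)) (∪-lub X⊆E C⊆E) (∩-⊆ˡ y)) ∩-⊆ʳ p∈D)))
      -- Hence `D` is spanned by any one of its points, and `p` ∈ B puts all of it into B.
      rD≤1 : r M D ≤ 1
      rD≤1 = ℕₚ.+-cancelˡ-≤ (r M C) _ _ (begin
        r M C ℕ.+ r M D          ≡⟨ r-project (⁅⁆-⊆ (X⊆E x∈X)) ⟩
        r M (⁅ x ⁆ ∪ C)          ≤⟨ r-∪ M (⁅⁆-⊆ (X⊆E x∈X)) C⊆E ⟩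
        r M ⁅ x ⁆ ℕ.+ r M C      ≡⟨ cong (ℕ._+ r M C) (ll x (X⊆E x∈X)) ⟩
        1 ℕ.+ r M C              ≡⟨ ℕₚ.+-comm 1 (r M C) ⟩
        r M C ℕ.+ 1 ∎)
      D⊆B : D ⊆ B
      D⊆B = flat-max M (flat fB) D⊆E (begin
        r M D       ≤⟨ rD≤1 ⟩
        1           ≡⟨ sym (ll p (D⊆E p∈D)) ⟩
        r M ⁅ p ⁆   ≤⟨ mono M (⁅⁆-⊆ (x∈p∩q⁺ (p∈B , p∈D))) (λ y → D⊆E (∩-⊆ʳ y)) ⟩
        r M (B ∩ D) ∎)

  -- By `compl-r`, joining C raises the ranks of subsets of Z by r(C), which turns both conditions
  -- relative to r(Z) into those relative to r(E).
  Complement-trans : {D : Subset n} → X ⊆ Z → D ⊆ Z → Complement ((M ∣ Z) Z⊆E) X D → Complement M X (cl M (C ∪ D))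
  Complement-trans {X = X} {D = D} X⊆Z D⊆Z (eq , le) =
    (begin-equality
      r M (cl M (C ∪ D)) ℕ.+ r M X     ≡⟨ cong (ℕ._+ r M X) (trans (r-cl M (C∪⊆E D⊆Z)) (compl-r D⊆Z)) ⟩
      r M C ℕ.+ r M D ℕ.+ r M X        ≡⟨ ℕₚ.+-assoc (r M C) _ _ ⟩
      r M C ℕ.+ (r M D ℕ.+ r M X)      ≡⟨ cong (r M C ℕ.+_) eq ⟩
      r M C ℕ.+ r M Z                  ≡⟨ proj₁ compl ⟩
      rank M ∎) ,
    (begin
      rank M                           ≡⟨ sym (proj₁ compl) ⟩
      r M C ℕ.+ r M Z                  ≤⟨ ℕₚ.+-monoʳ-≤ (r M C) le ⟩
      r M C ℕ.+ r M (D ∪ X)            ≡⟨ sym (compl-r (∪-lub D⊆Z X⊆Z)) ⟩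
      r M (C ∪ (D ∪ X))
        ≤⟨ mono M (∪-lub (λ x → ∪-⊆ˡ (⊆-cl M (C∪⊆E D⊆Z) (∪-⊆ˡ x)))
             (∪-mono (λ x → ⊆-cl M (C∪⊆E D⊆Z) (∪-⊆ʳ x)) (λ x → x))) (∪-lub (cl-⊆E M {X = C ∪ D}) (λ x → Z⊆E (X⊆Z x))) ⟩
      r M (cl M (C ∪ D) ∪ X) ∎)

-- Since Z is modular and E = Z ∪ X, r(Z) - r(X ∩ Z) = r(E) - r(X), so D has the right rank in M. It
-- spans E together with X because with X ∩ Z it already spans Z.
Complement-join : (M : Matroid n) {Z X D : Subset n} (Z⊆E : Z ⊆ E M) → Modular M Z → IsFlat M X → E M ⊆ Z ∪ X → D ⊆ Z →
                  Complement ((M ∣ Z) Z⊆E) (X ∩ Z) D → Complement M X D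
Complement-join M {Z} {X} {D} Z⊆E (fZ , md) fX cover D⊆Z (eq , le) =
  ℕₚ.+-cancelʳ-≡ (r M (X ∩ Z)) _ _ (begin-equality
    r M D ℕ.+ r M X ℕ.+ r M (X ∩ Z)    ≡⟨ solve 3 (λ a b c → a :+ b :+ c := (a :+ c) :+ b) refl (r M D) (r M X) (r M (X ∩ Z)) ⟩
    (r M D ℕ.+ r M (X ∩ Z)) ℕ.+ r M X  ≡⟨ cong (ℕ._+ r M X) eq ⟩
    r M Z ℕ.+ r M X
      ≡⟨ ℕₚ.≤-antisym (ℕₚ.≤-trans (md X fX) (ℕₚ.≤-trans
            (ℕₚ.+-mono-≤ (mono M (∩-glb ∩-⊆ʳ ∩-⊆ˡ) (λ x → X⊆E (∩-⊆ˡ x))) (mono M (∪-lub Z⊆E X⊆E) (λ x → x)))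
            (ℕₚ.≤-reflexive (ℕₚ.+-comm (r M (X ∩ Z)) (rank M)))))
           (submod M Z⊆E X⊆E cover ∩-⊆ʳ ∩-⊆ˡ) ⟩
    rank M ℕ.+ r M (X ∩ Z) ∎) ,
  ℕₚ.+-cancelʳ-≤ (r M Z) _ _ (begin
    rank M ℕ.+ r M Z                   ≤⟨ ℕₚ.+-monoʳ-≤ (rank M) le ⟩
    rank M ℕ.+ r M (D ∪ (X ∩ Z))
      ≤⟨ submod M (∪-lub (λ x → Z⊆E (D⊆Z x)) X⊆E) Z⊆E
           (λ x → [ ∪-⊆ʳ , (λ y → ∪-⊆ˡ (∪-⊆ʳ y)) ]′ (x∈p∪q⁻ Z X (cover x)))
           (∪-mono (λ x → x) ∩-⊆ˡ) (∪-lub D⊆Z ∩-⊆ʳ) ⟩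
    r M (D ∪ X) ℕ.+ r M Z ∎)
  where
  open ℕₚ.≤-Reasoning
  open +-*-Solver
  X⊆E : X ⊆ E M
  X⊆E = flat-⊆E M fX

-- Möbius functions

-- The sum form of the Möbius recursion. Candidates are compared by checking these equations, never
-- by unfolding `μ`.
IsMöbius : {P : Subset n → Set} → (∀ X → Dec (P X)) → Subset n → (Subset n → ℤ) → Set
IsMöbius {P = P} P? A g = ∀ W → P W → Σₛ (λ Y → when (P? Y ×-dec (Y ⊆? W)) (g Y)) ≡ when (W ≟ₛ A) 1ℤ

⊆⇒≡⊎⊂ : X ⊆ Y → X ≡ Y ⊎ X ⊂ Y
⊆⇒≡⊎⊂ {X = X} {Y = Y} X⊆Y with Y ⊆? X
... | yes Y⊆X = inj₁ (⊆-antisym X⊆Y Y⊆X)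
... | no Y⊈X  = inj₂ ((λ x → X⊆Y x) , ⊈⇒∃ Y⊈X)

module _ {P : Subset n → Set} (P? : ∀ X → Dec (P X)) where

  Σ-split : (g : Subset n → ℤ) (W : Subset n) → P W →
    Σₛ (λ Y → when (P? Y ×-dec (Y ⊆? W)) (g Y)) ≡ g W + Σₛ (λ Y → when (P? Y ×-dec (Y ⊂? W)) (g Y))
  Σ-split g W pW = begin
    Σₛ (λ Y → when (P? Y ×-dec (Y ⊆? W)) (g Y))
      ≡⟨ Σ-cong pointwise ⟩
    Σₛ (λ Y → when (Y ≟ₛ W) (g Y) + when (P? Y ×-dec (Y ⊂? W)) (g Y))
      ≡⟨ Σ-+ _ _ ⟩
    Σₛ (λ Y → when (Y ≟ₛ W) (g Y)) + Σₛ (λ Y → when (P? Y ×-dec (Y ⊂? W)) (g Y))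
      ≡⟨ cong (_+ Σₛ (λ Y → when (P? Y ×-dec (Y ⊂? W)) (g Y))) (Σ-δ W g) ⟩
    g W + Σₛ (λ Y → when (P? Y ×-dec (Y ⊂? W)) (g Y)) ∎
    where
    open ≡-Reasoning
    pointwise : ∀ Y → when (P? Y ×-dec (Y ⊆? W)) (g Y)
                    ≡ when (Y ≟ₛ W) (g Y) + when (P? Y ×-dec (Y ⊂? W)) (g Y)
    pointwise Y with Y ≟ₛ W
    ... | yes refl = trans (when-yes (P? Y ×-dec (Y ⊆? W)) (pW , λ x → x) (g Y))
                       (sym (trans (cong (g Y +_) (when-no (P? Y ×-dec (Y ⊂? Y)) (λ (_ , lt) → ⊂-irref refl lt) _))
                                   (ℤₚ.+-identityʳ (g Y))))
    ... | no Y≢W = trans (when-⇔ (P? Y ×-dec (Y ⊆? W)) (P? Y ×-dec (Y ⊂? W))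
                       (λ (p , le) → p , [ (λ eq → ⊥-elim (Y≢W eq)) , (λ lt → lt) ]′ (⊆⇒≡⊎⊂ le))
                       (λ (p , lt) → p , (λ x → proj₁ lt x)) (λ _ → refl))
                     (sym (ℤₚ.+-identityˡ _))

  -- The system is triangular: the equation at W determines the value at W from those at proper
  -- subsets.
  möbius-unique : ∀ {A g g′} → IsMöbius P? A g → IsMöbius P? A g′ → ∀ W → P W → g W ≡ g′ W
  möbius-unique {A} {g} {g′} mg mg′ W = go ∣ W ∣ W ℕₚ.≤-refl
    where
    go : ∀ m W → ∣ W ∣ ≤ m → P W → g W ≡ g′ W
    go m W W≤m pW = +-cancelʳ (Σₛ (λ Y → when (P? Y ×-dec (Y ⊂? W)) (g Y))) _ _ (begin
      g W + Σₛ (λ Y → when (P? Y ×-dec (Y ⊂? W)) (g Y))   ≡⟨ sym (Σ-split g W pW) ⟩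
      Σₛ (λ Y → when (P? Y ×-dec (Y ⊆? W)) (g Y))         ≡⟨ trans (mg W pW) (sym (mg′ W pW)) ⟩
      Σₛ (λ Y → when (P? Y ×-dec (Y ⊆? W)) (g′ Y))        ≡⟨ Σ-split g′ W pW ⟩
      g′ W + Σₛ (λ Y → when (P? Y ×-dec (Y ⊂? W)) (g′ Y))
        ≡⟨ cong (g′ W +_) (Σ-cong (λ Y → when-cong (P? Y ×-dec (Y ⊂? W)) (λ (pY , lt) → sym (below m W≤m pY lt)))) ⟩
      g′ W + Σₛ (λ Y → when (P? Y ×-dec (Y ⊂? W)) (g Y))  ∎)
      where
      open ≡-Reasoning
      below : ∀ m → ∣ W ∣ ≤ m → ∀ {Y} → P Y → Y ⊂ W → g Y ≡ g′ Y
      below zero    le pY lt = ⊥-elim (ℕₚ.n≮0 (ℕₚ.<-≤-trans (p⊂q⇒∣p∣<∣q∣ lt) le))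
      below (suc m) le {Y} pY lt = go m Y (ℕₚ.≤-pred (ℕₚ.≤-trans (p⊂q⇒∣p∣<∣q∣ lt) le)) pY

-- For W in S the Möbius equation at W involves members of S only. Hence Möbius values can be
-- transported between parts of lattices, such as [F, Z] or the flats with a given trace on Z.
record DownSet {P : Subset n → Set} (P? : ∀ X → Dec (P X)) (S : Subset n → Set) : Set where
  field
    S?   : ∀ X → Dec (S X)
    S⊆P  : ∀ {Y} → S Y → P Y
    down : ∀ {Y W} → S W → P Y → Y ⊆ W → S Y

module _ {P P′ S S′ : Subset n → Set} {P? : ∀ X → Dec (P X)} {P′? : ∀ X → Dec (P′ X)}
         (DS : DownSet P? S) (DS′ : DownSet P′? S′)
         (φ ψ : Subset n → Subset n)
         (φ-S : ∀ {X} → S X → S′ (φ X)) (ψ-S : ∀ {Y} → S′ Y → S (ψ Y))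
         (ψφ : ∀ {X} → S X → ψ (φ X) ≡ X) (φψ : ∀ {Y} → S′ Y → φ (ψ Y) ≡ Y)
         (φ-mono : ∀ {X Y} → S X → S Y → X ⊆ Y → φ X ⊆ φ Y)
         (ψ-mono : ∀ {X Y} → S′ X → S′ Y → X ⊆ Y → ψ X ⊆ ψ Y)
         {A A′ : Subset n} (φA : φ A ≡ A′) (ψA′ : ψ A′ ≡ A) where

  private
    module D = DownSet DS
    module D′ = DownSet DS′

  -- Pulled back along `φ`, the function g′ satisfies the same equations on S as g, and these have
  -- one solution.
  möbius-iso : ∀ {g g′} → IsMöbius P? A g → IsMöbius P′? A′ g′ → ∀ W → S W → g W ≡ g′ (φ W)
  möbius-iso {g} {g′} mg mg′ = möbius-unique D.S? left right
    where
    left : IsMöbius D.S? A g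
    left W sW = trans
      (Σ-cong (λ Y → when-⇔ (D.S? Y ×-dec (Y ⊆? W)) (P? Y ×-dec (Y ⊆? W))
        (λ (s , le) → D.S⊆P s , λ x → le x) (λ (p , le) → D.down sW p (λ x → le x) , λ x → le x) (λ _ → refl)))
      (mg W (D.S⊆P sW))
    right : IsMöbius D.S? A (λ Y → g′ (φ Y))
    right W sW = begin
      Σₛ (λ Y → when (D.S? Y ×-dec (Y ⊆? W)) (g′ (φ Y)))
        ≡⟨ Σ-reindex (λ Y → D.S? Y ×-dec (Y ⊆? W)) (λ Y → P′? Y ×-dec (Y ⊆? φ W)) φ ψ
             (λ Y (s , le) → D′.S⊆P (φ-S s) , φ-mono s sW le)
             (λ Y (p , le) → let s′ = D′.down (φ-S sW) p le in
                ψ-S s′ , λ x → subst (_ ∈_) (ψφ sW) (ψ-mono s′ (φ-S sW) le x))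
             (λ Y (s , _) → ψφ s)
             (λ Y (p , le) → φψ (D′.down (φ-S sW) p le))
             (λ _ _ → refl) ⟩
      Σₛ (λ Y → when (P′? Y ×-dec (Y ⊆? φ W)) (g′ Y))
        ≡⟨ mg′ (φ W) (D′.S⊆P (φ-S sW)) ⟩
      when (φ W ≟ₛ A′) 1ℤ
        ≡⟨ when-⇔ (φ W ≟ₛ A′) (W ≟ₛ A) (λ eq → trans (sym (ψφ sW)) (trans (cong ψ eq) ψA′))
             (λ eq → trans (cong φ eq) φA) (λ _ → refl) ⟩
      when (W ≟ₛ A) 1ℤ ∎
      where open ≡-Reasoning

Above : Matroid n → Subset n → Subset n → Set
Above M A Y = IsFlat M Y × A ⊆ Y

above? : (M : Matroid n) (A Y : Subset n) → Dec (Above M A Y)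
above? M A Y = isFlat? M Y ×-dec (A ⊆? Y)

module _ (M : Matroid n) where

  private
    below? : ∀ A F G → Dec (Above M A G × G ⊂ F)
    below? A F G = above? M A G ×-dec (G ⊂? F)

  flatsBetween-Σ : ∀ f A F → sumℤ M (map f (flatsBetween M A F)) ≡ Σₛ (λ G → when (below? A F G) (f G))
  flatsBetween-Σ f A F = trans (sum-filterᵇ _ f (allSubsets n)) (trans (sym (Σₛ-def _)) (Σ-cong pointwise))
    where
    pointwise : ∀ G → (if ⌊ isFlat? M G ⌋ ∧ (⌊ A ⊆? G ⌋ ∧ ⌊ G ⊂? F ⌋) then f G else 0ℤ) ≡ when (below? A F G) (f G)
    pointwise G with isFlat? M G | A ⊆? G | G ⊂? F
    ... | yes _ | yes _ | yes _ = refl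
    ... | yes _ | yes _ | no _  = refl
    ... | yes _ | no _  | yes _ = refl
    ... | yes _ | no _  | no _  = refl
    ... | no _  | yes _ | yes _ = refl
    ... | no _  | yes _ | no _  = refl
    ... | no _  | no _  | yes _ = refl
    ... | no _  | no _  | no _  = refl

  μ-step : Subset n → Subset n → (Subset n → ℤ) → ℤ
  μ-step A F f = if ⌊ F ≟ₛ A ⌋ then 1ℤ else - Σₛ (λ G → when (below? A F G) (f G))

  μ-step-cong : ∀ A F {f f′} → (∀ {G} → G ⊂ F → f G ≡ f′ G) → μ-step A F f ≡ μ-step A F f′
  μ-step-cong A F eq = cong (λ s → if ⌊ F ≟ₛ A ⌋ then 1ℤ else - s)
    (Σ-cong (λ G → when-cong (below? A F G) (λ (_ , lt) → eq lt)))

  -- At fuel 0 the bound leaves F without proper subsets, so the sum is empty and agrees with the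
  -- default 0 of `μ′`; `ℕ.pred` gives both cases one formula.
  μ′-unfold : ∀ k A F → ∣ F ∣ ≤ k → μ′ M k A F ≡ μ-step A F (μ′ M (ℕ.pred k) A)
  μ′-unfold zero A F le with F ≟ₛ A
  ... | yes _ = refl
  ... | no _  = sym (cong -_ (Σ-0 (λ G → when-no (below? A F G)
                  (λ (_ , lt) → ℕₚ.n≮0 (ℕₚ.<-≤-trans (p⊂q⇒∣p∣<∣q∣ lt) le)) _)))
  μ′-unfold (suc k) A F le = cong (λ s → if ⌊ F ≟ₛ A ⌋ then 1ℤ else - s) (flatsBetween-Σ (μ′ M k A) A F)

  -- The recursive values inside `μ` are computed with less fuel than `μ` itself. Each strict
  -- inclusion lowers the cardinality at least as fast as the fuel, so the value is unaffected.
  μ′-stable : ∀ m k k′ A F → ∣ F ∣ ≤ m → ∣ F ∣ ≤ k → ∣ F ∣ ≤ k′ → μ′ M k A F ≡ μ′ M k′ A F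
  μ′-stable m k k′ A F le-m le-k le-k′ =
    trans (μ′-unfold k A F le-k) (trans (μ-step-cong A F (rec m le-m)) (sym (μ′-unfold k′ A F le-k′)))
    where
    rec : ∀ m → ∣ F ∣ ≤ m → ∀ {G} → G ⊂ F → μ′ M (ℕ.pred k) A G ≡ μ′ M (ℕ.pred k′) A G
    rec zero    le lt = ⊥-elim (ℕₚ.n≮0 (ℕₚ.<-≤-trans (p⊂q⇒∣p∣<∣q∣ lt) le))
    rec (suc m) le {G} lt = μ′-stable m (ℕ.pred k) (ℕ.pred k′) A G (ℕₚ.≤-pred (ℕₚ.≤-trans (p⊂q⇒∣p∣<∣q∣ lt) le))
      (ℕₚ.<⇒≤pred (ℕₚ.≤-trans (p⊂q⇒∣p∣<∣q∣ lt) le-k))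
      (ℕₚ.<⇒≤pred (ℕₚ.≤-trans (p⊂q⇒∣p∣<∣q∣ lt) le-k′))

  μ-rec : ∀ A F → μ M A F ≡ μ-step A F (μ M A)
  μ-rec A F = trans (μ′-unfold (suc n) A F (ℕₚ.m≤n⇒m≤1+n (∣p∣≤n F)))
    (μ-step-cong A F (λ {G} _ → μ′-stable n n (suc n) A G (∣p∣≤n G) (∣p∣≤n G) (ℕₚ.m≤n⇒m≤1+n (∣p∣≤n G))))

  μ-möbius : ∀ A → IsMöbius (above? M A) A (μ M A)
  μ-möbius A W aW = trans (Σ-split (above? M A) (μ M A) W aW) (trans (cong (_+ s) (μ-rec A W)) (total (W ≟ₛ A)))
    where
    s : ℤ
    s = Σₛ (λ Y → when (below? A W Y) (μ M A Y))
    total : (d : Dec (W ≡ A)) → (if ⌊ d ⌋ then 1ℤ else - s) + s ≡ when d 1ℤ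
    total (yes refl) = trans (cong (1ℤ +_) (Σ-0 (λ Y → when-no (below? A A Y)
      (λ ((_ , A⊆Y) , _ , e , e∈A , e∉Y) → e∉Y (A⊆Y e∈A)) _))) refl
    total (no _)     = ℤₚ.+-inverseˡ s

  χContr-Σ : ∀ A k → χContr M A k ≡ Σₛ (λ Y → when (above? M A Y) (μ M A Y * (t^ (rank M ℕ.∸ r M Y)) k))
  χContr-Σ A k = trans (sum-filterᵇ _ (μ M A) (allSubsets n)) (trans (sym (Σₛ-def _)) (Σ-cong pointwise))
    where
    pointwise : ∀ Y → (if ⌊ isFlat? M Y ⌋ ∧ (⌊ A ⊆? Y ⌋ ∧ ⌊ rank M ℕ.∸ r M Y ℕ.≟ k ⌋) then μ M A Y else 0ℤ)
                    ≡ when (above? M A Y) (μ M A Y * (t^ (rank M ℕ.∸ r M Y)) k)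
    pointwise Y with isFlat? M Y | A ⊆? Y | rank M ℕ.∸ r M Y ℕ.≟ k
    ... | yes _ | yes _ | yes _ = sym (ℤₚ.*-identityʳ _)
    ... | yes _ | yes _ | no _  = sym (ℤₚ.*-zeroʳ (μ M A Y))
    ... | yes _ | no _  | yes _ = refl
    ... | yes _ | no _  | no _  = refl
    ... | no _  | yes _ | yes _ = refl
    ... | no _  | yes _ | no _  = refl
    ... | no _  | no _  | yes _ = refl
    ... | no _  | no _  | no _  = refl

all-above : (M : Matroid n) (A : Subset n) → DownSet (above? M A) (Above M A)
all-above M A = record { S? = above? M A ; S⊆P = λ s → s ; down = λ _ p _ → p }

within : (M : Matroid n) (A Z : Subset n) → DownSet (above? M A) (λ Y → Above M A Y × Y ⊆ Z)
within M A Z = record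
  { S?   = λ Y → above? M A Y ×-dec (Y ⊆? Z)
  ; S⊆P  = proj₁
  ; down = λ (_ , W⊆Z) p Y⊆W → p , λ x → W⊆Z (Y⊆W x) }

-- The index set of the sum Q_A. A flat between A and such a Y has its trace on Z squeezed to A.
tracing : (M : Matroid n) (A Z : Subset n) → A ⊆ Z → DownSet (above? M A) (λ Y → Above M A Y × Y ∩ Z ≡ A)
tracing M A Z A⊆Z = record
  { S?   = λ Y → above? M A Y ×-dec ((Y ∩ Z) ≟ₛ A)
  ; S⊆P  = proj₁
  ; down = λ (_ , W∩Z≡A) (fY , A⊆Y) Y⊆W → (fY , λ x → A⊆Y x) ,
      ⊆-antisym (λ x → subst (_ ∈_) W∩Z≡A (x∈p∩q⁺ (Y⊆W (∩-⊆ˡ x) , ∩-⊆ʳ x))) (∩-glb A⊆Y A⊆Z) }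

μ-restrict : (M : Matroid n) (Z⊆E : Z ⊆ E M) → IsFlat M Z → ∀ {A} U → Above ((M ∣ Z) Z⊆E) A U →
             μ ((M ∣ Z) Z⊆E) A U ≡ μ M A U
μ-restrict {Z = Z} M Z⊆E fZ {A} = möbius-iso (all-above ((M ∣ Z) Z⊆E) A) (within M A Z) (λ X → X) (λ X → X)
  (λ (fX , A⊆X) → (flat-restrict⁻ M Z⊆E fZ fX , λ x → A⊆X x) , flat-⊆E ((M ∣ Z) Z⊆E) fX)
  (λ ((fX , A⊆X) , X⊆Z) → flat-restrict⁺ M Z⊆E fX X⊆Z , λ x → A⊆X x)
  (λ _ → refl) (λ _ → refl) (λ _ _ le → le) (λ _ _ le → le) refl refl
  (μ-möbius ((M ∣ Z) Z⊆E) A) (μ-möbius M A)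

χContr-complement : (M : Matroid n) (Z-mod : Modular M Z) (Z⊆E : Z ⊆ E M) → C ⊆ E M → Complement M Z C →
  ∀ {F} → IsFlat ((M ∣ Z) Z⊆E) F → ∀ k → χContr ((M ∣ Z) Z⊆E) F k ≡ χContr M (cl M (C ∪ F)) k
χContr-complement {Z = Z} {C = C} M Z-mod Z⊆E C⊆E compl {F} fF k = begin
  χContr N F k
    ≡⟨ χContr-Σ N F k ⟩
  Σₛ (λ U → when (above? N F U) (μ N F U * (t^ (rank N ℕ.∸ r M U)) k))
    ≡⟨ Σ-reindex (above? N F) (above? M F′) φ ψ (λ _ → φ-S) (λ _ → ψ-S) (λ _ → ψφ) (λ _ → φψ)
         (λ U aU → cong₂ _*_
           (möbius-iso (all-above N F) (all-above M F′) φ ψ φ-S ψ-S ψφ φψ φ-mono ψ-mono refl (ψφ (fF , λ x → x))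
             (μ-möbius N F) (μ-möbius M F′) U aU)
           (cong (λ e → (t^ e) k) (corank aU))) ⟩
  Σₛ (λ Y → when (above? M F′ Y) (μ M F′ Y * (t^ (rank M ℕ.∸ r M Y)) k))
    ≡⟨ sym (χContr-Σ M F′ k) ⟩
  χContr M F′ k ∎
  where
  open ≡-Reasoning
  N = (M ∣ Z) Z⊆E
  F′ = cl M (C ∪ F)
  φ ψ : Subset _ → Subset _
  φ U = cl M (C ∪ U)
  ψ Y = Y ∩ Z
  C∪⊆E : X ⊆ Z → C ∪ X ⊆ E M
  C∪⊆E X⊆Z = ∪-lub C⊆E (λ x → Z⊆E (X⊆Z x))
  ⊆Z : IsFlat N X → X ⊆ Z
  ⊆Z = flat-⊆E N
  flat : IsFlat N X → IsFlat M X
  flat = flat-restrict⁻ M Z⊆E (proj₁ Z-mod)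
  φ-mono : ∀ {X Y} → Above N F X → Above N F Y → X ⊆ Y → φ X ⊆ φ Y
  φ-mono _ (fY , _) X⊆Y = cl-mono M (∪-mono (λ x → x) X⊆Y) (C∪⊆E (⊆Z fY))
  ψ-mono : ∀ {X Y} → Above M F′ X → Above M F′ Y → X ⊆ Y → ψ X ⊆ ψ Y
  ψ-mono _ _ X⊆Y = ∩-glb (λ x → X⊆Y (∩-⊆ˡ x)) ∩-⊆ʳ
  φ-S : ∀ {X} → Above N F X → Above M F′ (φ X)
  φ-S (fX , F⊆X) = cl-flat M (C∪⊆E (⊆Z fX)) , cl-mono M (∪-mono (λ x → x) F⊆X) (C∪⊆E (⊆Z fX))
  ψφ : ∀ {X} → Above N F X → ψ (φ X) ≡ X
  ψφ (fX , _) = compl-∩ M Z-mod Z⊆E C⊆E compl (flat fX) (⊆Z fX)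
  ψ-S : ∀ {Y} → Above M F′ Y → Above N F (ψ Y)
  ψ-S (fY , F′⊆Y) = flat-restrict⁺ M Z⊆E (flat-∩ M fY (proj₁ Z-mod)) ∩-⊆ʳ ,
    ∩-glb (λ x → F′⊆Y (⊆-cl M (C∪⊆E (⊆Z fF)) (∪-⊆ʳ x))) (⊆Z fF)
  φψ : ∀ {Y} → Above M F′ Y → φ (ψ Y) ≡ Y
  φψ (fY , F′⊆Y) = compl-cl M Z-mod Z⊆E C⊆E compl fY (λ x → F′⊆Y (⊆-cl M (C∪⊆E (⊆Z fF)) (∪-⊆ˡ x)))
  -- Both r(Z) and r(U) grow by r(C), so the exponents of t agree.
  corank : ∀ {U} → Above N F U → r M Z ℕ.∸ r M U ≡ rank M ℕ.∸ r M (φ U)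
  corank {U} (fU , _) = begin
    r M Z ℕ.∸ r M U                             ≡⟨ sym (ℕₚ.[m+n]∸[m+o]≡n∸o (r M C) (r M Z) (r M U)) ⟩
    (r M C ℕ.+ r M Z) ℕ.∸ (r M C ℕ.+ r M U)
      ≡⟨ cong₂ ℕ._∸_ (proj₁ compl) (sym (trans (r-cl M (C∪⊆E (⊆Z fU))) (compl-r M Z-mod Z⊆E C⊆E compl (⊆Z fU)))) ⟩
    rank M ℕ.∸ r M (φ U) ∎

-- Stanley's modular factorization

-- μ_F(Y) is the sum of μ_F(U) μ_F(V) over all U ≤ Z and V ∧ Z = F with U ∨ V = Y, because the sum of the
-- right-hand side over Y ≤ W is a product of two sums of μ_F.
module _ (M : Matroid n) {Z F : Subset n} (Z-mod : Modular M Z) (Z⊆E : Z ⊆ E M) (fF : IsFlat M F) (F⊆Z : F ⊆ Z) where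

  private
    N = (M ∣ Z) Z⊆E
    open DownSet (within M F Z) using () renaming (S? to U?)
    open DownSet (tracing M F Z F⊆Z) using () renaming (S? to V?)
    m : Subset n → ℤ
    m = μ M F
    _⋎_ : Subset n → Subset n → Subset n
    U ⋎ V = cl M (U ∪ V)

  convolution : Subset n → ℤ
  convolution Y = Σₛ (λ U → Σₛ (λ V → when (U? U) (when (V? V) (when ((U ⋎ V) ≟ₛ Y) (m U * m V)))))

  private
    ∪⊆E : Above M F X → Above M F Y → X ∪ Y ⊆ E M
    ∪⊆E (fX , _) (fY , _) = ∪-lub (flat-⊆E M fX) (flat-⊆E M fY)

    ⋎-above : Above M F X → Above M F Y → Above M F (X ⋎ Y)
    ⋎-above aX aY = cl-flat M (∪⊆E aX aY) , λ x → ⊆-cl M (∪⊆E aX aY) (∪-⊆ˡ (proj₂ aX x))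

  -- Each pair (U, V) contributes to the single flat U ⋎ V. The weight `h` is the indicator of Y ⊆ W
  -- for the Möbius equation, and a power of t for the characteristic polynomial.
  Σ-convolution : (h : Subset n → ℤ) → Σₛ (λ Y → when (above? M F Y) (convolution Y * h Y))
    ≡ Σₛ (λ U → Σₛ (λ V → when (U? U) (when (V? V) (m U * m V * h (U ⋎ V)))))
  Σ-convolution h = begin
    Σₛ (λ Y → when (above? M F Y) (convolution Y * h Y))
      ≡⟨ Σ-cong (λ Y → trans (cong (when (above? M F Y)) (trans (sym (Σ-*ʳ (h Y) _)) (Σ-cong (λ U → sym (Σ-*ʳ (h Y) _)))))
           (trans (sym (Σ-when (above? M F Y) _)) (Σ-cong (λ U → sym (Σ-when (above? M F Y) _))))) ⟩
    Σₛ (λ Y → Σₛ (λ U → Σₛ (λ V → summand U V Y)))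
      ≡⟨ trans (Σ-swap _) (Σ-cong (λ U → Σ-swap _)) ⟩
    Σₛ (λ U → Σₛ (λ V → Σₛ (summand U V)))
      ≡⟨ Σ-cong (λ U → Σ-cong (collapse U)) ⟩
    Σₛ (λ U → Σₛ (λ V → when (U? U) (when (V? V) (m U * m V * h (U ⋎ V))))) ∎
    where
    open ≡-Reasoning
    summand : (U V Y : Subset n) → ℤ
    summand U V Y = when (above? M F Y) (when (U? U) (when (V? V) (when ((U ⋎ V) ≟ₛ Y) (m U * m V))) * h Y)
    collapse : ∀ U V → Σₛ (summand U V) ≡ when (U? U) (when (V? V) (m U * m V * h (U ⋎ V)))
    collapse U V with U? U | V? V
    ... | yes (aU , _) | yes (aV , _) = trans (Σ-cong point) (Σ-δ (U ⋎ V) (λ Y → m U * m V * h Y))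
      where
      point : ∀ Y → when (above? M F Y) (when ((U ⋎ V) ≟ₛ Y) (m U * m V) * h Y) ≡ when (Y ≟ₛ (U ⋎ V)) (m U * m V * h Y)
      point Y with (U ⋎ V) ≟ₛ Y
      ... | yes refl = trans (when-yes (above? M F Y) (⋎-above aU aV) _) (sym (when-yes (Y ≟ₛ Y) refl _))
      ... | no ≢     = trans (when-0 (above? M F Y)) (sym (when-no (Y ≟ₛ (U ⋎ V)) (λ eq → ≢ (sym eq)) _))
    ... | yes _ | no _  = Σ-0 (λ Y → when-0 (above? M F Y))
    ... | no _  | yes _ = Σ-0 (λ Y → when-0 (above? M F Y))
    ... | no _  | no _  = Σ-0 (λ Y → when-0 (above? M F Y))

  convolution-möbius : IsMöbius (above? M F) F convolution
  convolution-möbius W (fW , F⊆W) = begin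
    Σₛ (λ Y → when (above? M F Y ×-dec (Y ⊆? W)) (convolution Y))
      ≡⟨ Σ-cong indicator ⟩
    Σₛ (λ Y → when (above? M F Y) (convolution Y * when (Y ⊆? W) 1ℤ))
      ≡⟨ Σ-convolution (λ Y → when (Y ⊆? W) 1ℤ) ⟩
    Σₛ (λ U → Σₛ (λ V → when (U? U) (when (V? V) (m U * m V * when ((U ⋎ V) ⊆? W) 1ℤ))))
      ≡⟨ Σ-cong (λ U → trans (Σ-cong (separate U)) (Σ-*ˡ (a U) b)) ⟩
    Σₛ (λ U → a U * Σₛ b)
      ≡⟨ Σ-*ʳ (Σₛ b) a ⟩
    Σₛ a * Σₛ b
      ≡⟨ cong (_* Σₛ b) (μ-möbius M F (W ∩ Z) (flat-∩ M fW (proj₁ Z-mod) , ∩-glb F⊆W F⊆Z)) ⟩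
    when ((W ∩ Z) ≟ₛ F) 1ℤ * Σₛ b
      ≡⟨ conclude ⟩
    when (W ≟ₛ F) 1ℤ ∎
    where
    open ≡-Reasoning
    a b : Subset n → ℤ
    a U = when (above? M F U ×-dec (U ⊆? (W ∩ Z))) (m U)
    b V = when (V? V ×-dec (V ⊆? W)) (m V)
    indicator : ∀ Y → when (above? M F Y ×-dec (Y ⊆? W)) (convolution Y)
                    ≡ when (above? M F Y) (convolution Y * when (Y ⊆? W) 1ℤ)
    indicator Y with above? M F Y | Y ⊆? W
    ... | yes _ | yes _ = sym (ℤₚ.*-identityʳ _)
    ... | yes _ | no _  = sym (ℤₚ.*-zeroʳ (convolution Y))
    ... | no _  | yes _ = refl
    ... | no _  | no _  = refl
    -- As W is closed, U ⋎ V ⊆ W splits into a condition on U and one on V; together with U ⊆ Z the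
    -- former is U ⊆ W ∩ Z.
    separate : ∀ U V → when (U? U) (when (V? V) (m U * m V * when ((U ⋎ V) ⊆? W) 1ℤ)) ≡ a U * b V
    separate U V with U? U
    ... | no ¬u = sym (cong (_* b V) (when-no (above? M F U ×-dec (U ⊆? (W ∩ Z))) (λ (aU , le) → ¬u (aU , λ x → ∩-⊆ʳ (le x))) _))
    ... | yes (aU , U⊆Z) with V? V
    ... | no _ = sym (ℤₚ.*-zeroʳ (a U))
    ... | yes (aV , eqV) with (U ⋎ V) ⊆? W
    ... | yes ⊆W = trans (ℤₚ.*-identityʳ _) (sym (cong₂ _*_
            (when-yes (above? M F U ×-dec (U ⊆? (W ∩ Z))) (aU , ∩-glb (λ x → ⊆W (⊆-cl M (∪⊆E aU aV) (∪-⊆ˡ x))) U⊆Z) _)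
            (when-yes (yes (aV , eqV) ×-dec (V ⊆? W)) ((aV , eqV) , λ x → ⊆W (⊆-cl M (∪⊆E aU aV) (∪-⊆ʳ x))) _)))
    ... | no ⊈W with V ⊆? W
    ... | no _ = trans (ℤₚ.*-zeroʳ (m U * m V)) (sym (ℤₚ.*-zeroʳ (a U)))
    ... | yes V⊆W = trans (ℤₚ.*-zeroʳ (m U * m V)) (sym (cong (_* m V)
            (when-no (above? M F U ×-dec (U ⊆? (W ∩ Z)))
              (λ (_ , le) → ⊈W (cl-least M fW (∪-lub (λ x → ∩-⊆ˡ (le x)) V⊆W))) _)))
    -- The first factor vanishes unless W ∩ Z = F. In that case all flats between F and W have trace
    -- F as well, so the second factor is the full Möbius sum at W.
    conclude : when ((W ∩ Z) ≟ₛ F) 1ℤ * Σₛ b ≡ when (W ≟ₛ F) 1ℤ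
    conclude with (W ∩ Z) ≟ₛ F
    ... | no ≢ = sym (when-no (W ≟ₛ F) (λ { refl → ≢ (⊆-antisym ∩-⊆ˡ (∩-glb (λ x → x) F⊆Z)) }) _)
    ... | yes eq = trans (ℤₚ.*-identityˡ _) (trans
            (Σ-cong (λ V → when-⇔ (V? V ×-dec (V ⊆? W)) (above? M F V ×-dec (V ⊆? W))
              (λ ((aV , _) , le) → aV , λ x → le x)
              (λ (aV , le) → DownSet.down (tracing M F Z F⊆Z) ((fW , λ x → F⊆W x) , eq) aV (λ x → le x) , λ x → le x)
              (λ _ → refl)))
            (μ-möbius M F W (fW , λ x → F⊆W x)))

  -- Q_F. Modularity of Z gives r(V) - r(F) = r(Z ∪ V) - r(Z) ≤ r(E) - r(Z), so the truncated
  -- exponent is the true one.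
  cofactor : List ℤ
  cofactor = polynomial (allSubsets n) (λ V → when (V? V) (m V)) (λ V → (rank M ℕ.∸ r M Z) ℕ.∸ (r M V ℕ.∸ r M F))

  act-cofactor : ∀ d k → act cofactor d k
    ≡ Σₛ (λ V → when (V? V) (m V * shift ((rank M ℕ.∸ r M Z) ℕ.∸ (r M V ℕ.∸ r M F)) d k))
  act-cofactor d k = trans (act-polynomial (allSubsets n) _ _ d k) (trans (sym (Σₛ-def _))
    (Σ-cong (λ V → sym (when-*ʳ (V? V) _ (m V)))))

  private
    -- The point is r(U ⋎ V) + r(F) = r(U) + r(V). For U = Z it is modularity of Z at V, and
    -- submodularity carries it down to smaller U.
    corank : ∀ {U V} → Above M F U × U ⊆ Z → Above M F V × V ∩ Z ≡ F →
      rank M ℕ.∸ r M (U ⋎ V) ≡ ((rank M ℕ.∸ r M Z) ℕ.∸ (r M V ℕ.∸ r M F)) ℕ.+ (r M Z ℕ.∸ r M U)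
    corank {U} {V} (aU@(fU , F⊆U) , U⊆Z) (aV@(fV , F⊆V) , V∩Z≡F) =
      exponents (mono M F⊆V V⊆E) (mono M U⊆Z Z⊆E) (mono M Z⊆E (λ x → x))
        (ℕₚ.≤-trans ZV (ℕₚ.+-monoʳ-≤ (r M F) (mono M (∪-lub Z⊆E V⊆E) (λ x → x))))
        (trans (cong (ℕ._+ r M F) (r-cl M (∪⊆E aU aV))) (ℕₚ.≤-antisym
          (submod M U⊆E V⊆E (λ x → x) F⊆U F⊆V)
          (ℕₚ.≤-trans (+-chain {a = r M Z} {c = r M F} ZV
              (ℕₚ.≤-trans (submod M {X = Z ∪ V} (∪⊆E aU aV) Z⊆E (∪-lub ∪-⊆ʳ (λ x → ∪-⊆ˡ (∪-⊆ʳ x))) ∪-⊆ˡ U⊆Z)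
                (ℕₚ.≤-reflexive (ℕₚ.+-comm (r M (U ∪ V)) (r M Z)))))
            (ℕₚ.≤-reflexive (ℕₚ.+-comm (r M F) _)))))
      where
      U⊆E = flat-⊆E M fU
      V⊆E = flat-⊆E M fV
      ZV : r M Z ℕ.+ r M V ≤ r M F ℕ.+ r M (Z ∪ V)
      ZV = subst (λ X → r M Z ℕ.+ r M V ≤ r M X ℕ.+ r M (Z ∪ V)) (trans (∩-comm Z V) V∩Z≡F) (proj₂ Z-mod V fV)
      -- All differences are replaced by witnesses v′, z′, e′, w of the inequalities, so that no
      -- subtraction is truncated.
      exponents : ∀ {f u v z e j} → f ≤ v → u ≤ z → z ≤ e → z ℕ.+ v ≤ f ℕ.+ e → j ℕ.+ f ≡ u ℕ.+ v →
                  e ℕ.∸ j ≡ ((e ℕ.∸ z) ℕ.∸ (v ℕ.∸ f)) ℕ.+ (z ℕ.∸ u)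
      exponents {f} {u} {v} {z} {e} {j} f≤v u≤z z≤e zv≤ eqj
        with ℕₚ.m≤n⇒∃[o]m+o≡n f≤v | ℕₚ.m≤n⇒∃[o]m+o≡n u≤z | ℕₚ.m≤n⇒∃[o]m+o≡n z≤e
      ... | v′ , refl | z′ , refl | e′ , refl
        with ℕₚ.m≤n⇒∃[o]m+o≡n {v′} {e′} (ℕₚ.+-cancelˡ-≤ (f ℕ.+ (u ℕ.+ z′)) v′ e′
               (subst₂ _≤_ (solve 4 (λ u z f v → (u :+ z) :+ (f :+ v) := (f :+ (u :+ z)) :+ v) refl u z′ f v′)
                           (sym (ℕₚ.+-assoc f _ e′)) zv≤))
        where open +-*-Solver
      ... | w , refl = begin
        (u ℕ.+ z′ ℕ.+ (v′ ℕ.+ w)) ℕ.∸ j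
          ≡⟨ cong₂ ℕ._∸_ (solve 4 (λ u z v w → u :+ z :+ (v :+ w) := (u :+ v) :+ (w :+ z)) refl u z′ v′ w) j≡ ⟩
        (u ℕ.+ v′ ℕ.+ (w ℕ.+ z′)) ℕ.∸ (u ℕ.+ v′)
          ≡⟨ ℕₚ.m+n∸m≡n (u ℕ.+ v′) _ ⟩
        w ℕ.+ z′
          ≡⟨ sym (cong₂ ℕ._+_ (trans (cong₂ ℕ._∸_ (ℕₚ.m+n∸m≡n (u ℕ.+ z′) _) (ℕₚ.m+n∸m≡n f v′)) (ℕₚ.m+n∸m≡n v′ w)) (ℕₚ.m+n∸m≡n u z′)) ⟩
        ((u ℕ.+ z′ ℕ.+ (v′ ℕ.+ w)) ℕ.∸ (u ℕ.+ z′) ℕ.∸ (f ℕ.+ v′ ℕ.∸ f)) ℕ.+ (u ℕ.+ z′ ℕ.∸ u) ∎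
        where
        open ≡-Reasoning
        open +-*-Solver
        j≡ : j ≡ u ℕ.+ v′
        j≡ = ℕₚ.+-cancelʳ-≡ f _ _ (trans eqj (solve 3 (λ u f v → u :+ (f :+ v) := (u :+ v) :+ f) refl u f v′))

  -- The exponent of a pair (U, V) is a sum of one term in V and one in U, so for fixed V the sum
  -- over U is a power of t times the characteristic polynomial of N/F.
  χContr-factor : ∀ k → χContr M F k ≡ act cofactor (χContr N F) k
  χContr-factor k = begin
    χContr M F k
      ≡⟨ χContr-Σ M F k ⟩
    Σₛ (λ Y → when (above? M F Y) (m Y * t (rank M ℕ.∸ r M Y)))
      ≡⟨ Σ-cong (λ Y → when-cong (above? M F Y) (λ aY → cong (_* t (rank M ℕ.∸ r M Y))
           (möbius-unique (above? M F) (μ-möbius M F) convolution-möbius Y aY))) ⟩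
    Σₛ (λ Y → when (above? M F Y) (convolution Y * t (rank M ℕ.∸ r M Y)))
      ≡⟨ Σ-convolution (λ Y → t (rank M ℕ.∸ r M Y)) ⟩
    Σₛ (λ U → Σₛ (λ V → when (U? U) (when (V? V) (m U * m V * t (rank M ℕ.∸ r M (U ⋎ V))))))
      ≡⟨ Σ-swap _ ⟩
    Σₛ (λ V → Σₛ (λ U → when (U? U) (when (V? V) (m U * m V * t (rank M ℕ.∸ r M (U ⋎ V))))))
      ≡⟨ Σ-cong (λ V → trans (Σ-cong (λ U → when-comm (U? U) (V? V) _)) (Σ-when (V? V) _)) ⟩
    Σₛ (λ V → when (V? V) (Σₛ (λ U → when (U? U) (m U * m V * t (rank M ℕ.∸ r M (U ⋎ V))))))
      ≡⟨ Σ-cong (λ V → when-cong (V? V) (inner V)) ⟩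
    Σₛ (λ V → when (V? V) (m V * shift (e V) (χContr N F) k))
      ≡⟨ sym (act-cofactor (χContr N F) k) ⟩
    act cofactor (χContr N F) k ∎
    where
    open ≡-Reasoning
    t : ℕ → ℤ
    t a = (t^ a) k
    e : Subset n → ℕ
    e V = (rank M ℕ.∸ r M Z) ℕ.∸ (r M V ℕ.∸ r M F)
    inner : ∀ V → Above M F V × V ∩ Z ≡ F →
      Σₛ (λ U → when (U? U) (m U * m V * t (rank M ℕ.∸ r M (U ⋎ V)))) ≡ m V * shift (e V) (χContr N F) k
    inner V aV = begin
      Σₛ (λ U → when (U? U) (m U * m V * t (rank M ℕ.∸ r M (U ⋎ V))))
        ≡⟨ Σ-cong (λ U → trans (point U) (when-*ˡ (above? N F U) (m V) _)) ⟩
      Σₛ (λ U → m V * when (above? N F U) (μ N F U * t (e V ℕ.+ (r M Z ℕ.∸ r M U))))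
        ≡⟨ Σ-*ˡ (m V) _ ⟩
      m V * Σₛ (λ U → when (above? N F U) (μ N F U * t (e V ℕ.+ (r M Z ℕ.∸ r M U))))
        ≡⟨ cong (m V *_) (sym (begin
             shift (e V) (χContr N F) k
               ≡⟨ shift-cong (e V) (χContr-Σ N F) k ⟩
             shift (e V) (λ k → Σₛ (λ U → when (above? N F U) (μ N F U * (t^ (r M Z ℕ.∸ r M U)) k))) k
               ≡⟨ shift-Σ (e V) (λ U k → when (above? N F U) (μ N F U * (t^ (r M Z ℕ.∸ r M U)) k)) k ⟩
             Σₛ (λ U → shift (e V) (λ k → when (above? N F U) (μ N F U * (t^ (r M Z ℕ.∸ r M U)) k)) k)
               ≡⟨ Σ-cong (λ U → trans (shift-when (e V) (above? N F U) _ k)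
                    (cong (when (above? N F U)) (trans (shift-* (e V) (μ N F U) (t^ (r M Z ℕ.∸ r M U)) k)
                      (cong (μ N F U *_) (shift-t^ (e V) (r M Z ℕ.∸ r M U) k))))) ⟩
             Σₛ (λ U → when (above? N F U) (μ N F U * t (e V ℕ.+ (r M Z ℕ.∸ r M U)))) ∎)) ⟩
      m V * shift (e V) (χContr N F) k ∎
      where
      rearrange : ∀ x y z → x * y * z ≡ y * (x * z)
      rearrange = solve-∀
      point : ∀ U → when (U? U) (m U * m V * t (rank M ℕ.∸ r M (U ⋎ V)))
                  ≡ when (above? N F U) (m V * (μ N F U * t (e V ℕ.+ (r M Z ℕ.∸ r M U))))
      point U = when-⇔ (U? U) (above? N F U)
        (λ ((fU , F⊆U) , U⊆Z) → flat-restrict⁺ M Z⊆E fU U⊆Z , λ x → F⊆U x)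
        (λ (fU , F⊆U) → (flat-restrict⁻ M Z⊆E (proj₁ Z-mod) fU , λ x → F⊆U x) , flat-⊆E N fU)
        (λ aU@((fU , F⊆U) , U⊆Z) → trans (rearrange (m U) (m V) _)
          (cong (m V *_) (cong₂ _*_
            (sym (μ-restrict M Z⊆E (proj₁ Z-mod) U (flat-restrict⁺ M Z⊆E fU U⊆Z , λ x → F⊆U x)))
            (cong t (corank aU aV)))))

-- Modularity of Z at V gives r(Z ∪ V) ≥ r(Z) + r(V). Thus V is independent over Z, and joining it
-- to F loses no rank and captures no new element of Z.
join-trace : (M : Matroid n) {Z F V : Subset n} → Modular M Z → IsFlat M F → IsFlat M V → F ⊆ Z → Disjoint V Z →
             cl M (F ∪ V) ∩ Z ≡ F × r M (F ∪ V) ≡ r M F ℕ.+ r M V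
join-trace M {Z} {F} {V} (fZ , md) fF fV F⊆Z dis =
  sym (flat-≤ M fF (∩-glb (λ x → ⊆-cl M F∪V⊆E (∪-⊆ˡ x)) F⊆Z) (λ x → Z⊆E (∩-⊆ʳ x))
    (ℕₚ.+-cancelˡ-≤ (r M Z ℕ.+ r M V) _ _ (begin
      r M Z ℕ.+ r M V ℕ.+ r M (W ∩ Z)      ≤⟨ ℕₚ.+-monoˡ-≤ _ ZV ⟩
      r M (Z ∪ V) ℕ.+ r M (W ∩ Z)
        ≤⟨ submod M Z⊆E (cl-⊆E M {X = F ∪ V}) (∪-mono (λ x → x) (λ x → ⊆-cl M F∪V⊆E (∪-⊆ʳ x))) ∩-⊆ʳ ∩-⊆ˡ ⟩
      r M Z ℕ.+ r M W                      ≤⟨ ℕₚ.+-monoʳ-≤ (r M Z) (ℕₚ.≤-trans (ℕₚ.≤-reflexive (r-cl M F∪V⊆E)) upper) ⟩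
      r M Z ℕ.+ (r M F ℕ.+ r M V)          ≡⟨ solve 3 (λ z f v → z :+ (f :+ v) := z :+ v :+ f) refl (r M Z) (r M F) (r M V) ⟩
      r M Z ℕ.+ r M V ℕ.+ r M F ∎))) ,
  ℕₚ.≤-antisym upper (ℕₚ.+-cancelˡ-≤ (r M Z) _ _ (begin
    r M Z ℕ.+ (r M F ℕ.+ r M V)            ≡⟨ solve 3 (λ z f v → z :+ (f :+ v) := z :+ v :+ f) refl (r M Z) (r M F) (r M V) ⟩
    r M Z ℕ.+ r M V ℕ.+ r M F              ≤⟨ ℕₚ.+-monoˡ-≤ (r M F) ZV ⟩
    r M (Z ∪ V) ℕ.+ r M F                  ≤⟨ submod M Z⊆E F∪V⊆E (∪-mono (λ x → x) ∪-⊆ʳ) F⊆Z ∪-⊆ˡ ⟩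
    r M Z ℕ.+ r M (F ∪ V) ∎))
  where
  open ℕₚ.≤-Reasoning
  open +-*-Solver
  W = cl M (F ∪ V)
  Z⊆E : Z ⊆ E M
  Z⊆E = flat-⊆E M fZ
  F∪V⊆E : F ∪ V ⊆ E M
  F∪V⊆E = ∪-lub (flat-⊆E M fF) (flat-⊆E M fV)
  upper : r M (F ∪ V) ≤ r M F ℕ.+ r M V
  upper = r-∪ M (flat-⊆E M fF) (flat-⊆E M fV)
  ZV : r M Z ℕ.+ r M V ≤ r M (Z ∪ V)
  ZV = subst (λ s → r M Z ℕ.+ r M V ≤ s ℕ.+ r M (Z ∪ V)) (Disjoint⇒r≡0 M (λ z v → dis v z)) (md V fV)

-- V ↦ F ∪ V maps the flats V with V ∩ Z = ∅ isomorphically to the flats Y with Y ∩ Z = F.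
act-cofactor-const : (M : Matroid n) (∅-fl : IsFlat M ∅) (Z-mod : Modular M Z) (Z⊆E : Z ⊆ E M) →
  Modular M X → E M ⊆ Z ∪ X →
  ∀ {F} (fF : IsFlat M F) (F⊆Z : F ⊆ Z) → Disjoint F X → ∀ d k →
  act (cofactor M Z-mod Z⊆E fF F⊆Z) d k ≡ act (cofactor M Z-mod Z⊆E ∅-fl (⊆-min Z)) d k
act-cofactor-const {Z = Z} {X = X} M ∅-fl Z-mod Z⊆E X-mod cover {F} fF F⊆Z disF d k = sym (begin
  act (cofactor M Z-mod Z⊆E ∅-fl (⊆-min Z)) d k
    ≡⟨ act-cofactor M Z-mod Z⊆E ∅-fl (⊆-min Z) d k ⟩
  Σₛ (λ V → when (D₀.S? V) (μ M ∅ V * shift ((rank M ℕ.∸ r M Z) ℕ.∸ (r M V ℕ.∸ r M ∅)) d k))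
    ≡⟨ Σ-reindex D₀.S? D.S? (F ∪_) (_∩ X) (λ _ → φ-S) (λ _ → ψ-S) (λ _ → ψφ) (λ _ → φψ)
         (λ V sV → cong₂ (λ a e → a * shift ((rank M ℕ.∸ r M Z) ℕ.∸ e) d k)
           (möbius-iso (tracing M ∅ Z (⊆-min Z)) (tracing M F Z F⊆Z) (F ∪_) (_∩ X) φ-S ψ-S ψφ φψ
              (λ _ _ le → ∪-mono (λ x → x) le) (λ _ _ le → ∩-glb (λ x → le (∩-⊆ˡ x)) ∩-⊆ʳ)
              (∪-identityʳ F) (Empty-unique (λ (e , e∈) → disF (∩-⊆ˡ e∈) (∩-⊆ʳ e∈)))
              (μ-möbius M ∅) (μ-möbius M F) V sV)
           (height sV)) ⟩
  Σₛ (λ Y → when (D.S? Y) (μ M F Y * shift ((rank M ℕ.∸ r M Z) ℕ.∸ (r M Y ℕ.∸ r M F)) d k))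
    ≡⟨ sym (act-cofactor M Z-mod Z⊆E fF F⊆Z d k) ⟩
  act (cofactor M Z-mod Z⊆E fF F⊆Z) d k ∎)
  where
  open ≡-Reasoning
  S₀ S : Subset _ → Set
  S₀ V = Above M ∅ V × V ∩ Z ≡ ∅
  S Y = Above M F Y × Y ∩ Z ≡ F
  module D₀ = DownSet (tracing M ∅ Z (⊆-min Z))
  module D = DownSet (tracing M F Z F⊆Z)
  disj : ∀ {V} → S₀ V → Disjoint V Z
  disj (_ , eq) x∈V x∈Z = ∉⊥ (subst (_ ∈_) eq (x∈p∩q⁺ (x∈V , x∈Z)))
  ⊆X : ∀ {V} → S₀ V → V ⊆ X
  ⊆X sV@((fV , _) , _) x∈V = [ (λ x∈Z → ⊥-elim (disj sV x∈V x∈Z)) , (λ x → x) ]′ (x∈p∪q⁻ Z X (cover (flat-⊆E M fV x∈V)))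
  height : ∀ {V} → S₀ V → r M V ℕ.∸ r M ∅ ≡ r M (F ∪ V) ℕ.∸ r M F
  height {V} sV@((fV , _) , _) = trans (cong (r M V ℕ.∸_) (r-∅ M))
    (sym (trans (cong (ℕ._∸ r M F) (proj₂ (join-trace M Z-mod fF fV F⊆Z (disj sV)))) (ℕₚ.m+n∸m≡n (r M F) (r M V))))
  ψφ : ∀ {V} → S₀ V → (F ∪ V) ∩ X ≡ V
  ψφ {V} sV = ⊆-antisym
    (λ x → [ (λ x∈F → ⊥-elim (disF x∈F (∩-⊆ʳ x))) , (λ v → v) ]′ (x∈p∪q⁻ F V (∩-⊆ˡ x)))
    (∩-glb ∪-⊆ʳ (⊆X sV))
  φψ : ∀ {Y} → S Y → F ∪ (Y ∩ X) ≡ Y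
  φψ ((fY , F⊆Y) , eq) = ⊆-antisym (∪-lub F⊆Y ∩-⊆ˡ)
    (λ y → [ (λ z → ∪-⊆ˡ (subst (_ ∈_) eq (x∈p∩q⁺ (y , z)))) , (λ x → ∪-⊆ʳ (x∈p∩q⁺ (y , x))) ]′
             (x∈p∪q⁻ Z X (cover (flat-⊆E M fY y))))
  ψ-S : ∀ {Y} → S Y → S₀ (Y ∩ X)
  ψ-S ((fY , F⊆Y) , eq) = (flat-∩ M fY (proj₁ X-mod) , ⊆-min _) ,
    Empty-unique (λ (e , e∈) → disF (subst (e ∈_) eq (x∈p∩q⁺ (∩-⊆ˡ (∩-⊆ˡ e∈) , ∩-⊆ʳ e∈))) (∩-⊆ʳ (∩-⊆ˡ e∈)))
  φ-S : ∀ {V} → S₀ V → S (F ∪ V)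
  φ-S {V} sV@((fV , _) , _) = (subst (IsFlat M) closed (cl-flat M F∪V⊆E) , ∪-⊆ˡ) ,
    trans (cong (_∩ Z) (sym closed)) onZ
    where
    F∪V⊆E = ∪-lub (flat-⊆E M fF) (flat-⊆E M fV)
    onZ : cl M (F ∪ V) ∩ Z ≡ F
    onZ = proj₁ (join-trace M Z-mod fF fV F⊆Z (disj sV))
    -- The roles are exchanged: V lies in the modular flat X, and F is disjoint from it. As Z and X
    -- cover E, the two traces show that F ∪ V is already closed.
    onX : cl M (F ∪ V) ∩ X ≡ V
    onX = trans (cong (λ S → cl M S ∩ X) (∪-comm F V)) (proj₁ (join-trace M X-mod fV fF (⊆X sV) disF))
    closed : cl M (F ∪ V) ≡ F ∪ V
    closed = ⊆-antisym
      (λ x → [ (λ z → ∪-⊆ˡ (subst (_ ∈_) onZ (x∈p∩q⁺ (x , z)))) , (λ y → ∪-⊆ʳ (subst (_ ∈_) onX (x∈p∩q⁺ (x , y)))) ]′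
               (x∈p∪q⁻ Z X (cover (cl-⊆E M {X = F ∪ V} x))))
      (⊆-cl M F∪V⊆E)

-- Divisional chains

_∣ᵃ_ : (ℕ → ℤ) → (ℕ → ℤ) → Set
d ∣ᵃ p = ∃[ q ] (∀ k → p k ≡ act q d k)

record Step (M : Matroid n) (A B : Subset n) : Set where
  constructor step
  field
    flat₁ : IsFlat M A
    flat₂ : IsFlat M B
    sub   : A ⊆ B
    ranks : r M B ≡ suc (r M A)
    divs  : χContr M B ∣ᵃ χContr M A

Path : Matroid n → Subset n → Subset n → Set
Path M = Star (Step M)

path-⊆ : (M : Matroid n) → Path M A B → A ⊆ B
path-⊆ M ε       x = x
path-⊆ M (s ◅ p) x = path-⊆ M p (Step.sub s x)

path-flat : (M : Matroid n) → IsFlat M A → Path M A B → IsFlat M B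
path-flat M fA ε       = fA
path-flat M fA (s ◅ p) = path-flat M (Step.flat₂ s) p

module _ (M : Matroid n) (Z-mod : Modular M Z) (Z⊆E : Z ⊆ E M) where

  -- Disjointness of the last flat from X is inherited by the whole chain. All its cofactors then
  -- equal the one at ∅, and each quotient is kept.
  path-join : Modular M X → Loopless M → E M ⊆ Z ∪ X → Disjoint B X → Path ((M ∣ Z) Z⊆E) A B → Path M A B
  path-join X-mod ll cover dis ε = ε
  path-join {X = X} X-mod ll cover dis (_◅_ {A} {B} s p) = step fA fB sub ranks
    (proj₁ divs , λ k → begin
      χContr M A k                          ≡⟨ factor fA (⊆Z flat₁) (λ x → dis (path-⊆ N p (sub x))) k ⟩
      act Q (χContr N A) k                  ≡⟨ act-cong Q (proj₂ divs) k ⟩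
      act Q (act (proj₁ divs) (χContr N B)) k ≡⟨ act-comm Q (proj₁ divs) (χContr N B) k ⟩
      act (proj₁ divs) (act Q (χContr N B)) k
        ≡⟨ act-cong (proj₁ divs) (λ k → sym (factor fB (⊆Z flat₂) (λ x → dis (path-⊆ N p x)) k)) k ⟩
      act (proj₁ divs) (χContr M B) k ∎)
    ◅ path-join X-mod ll cover dis p
    where
    open ≡-Reasoning
    open Step s
    N = (M ∣ Z) Z⊆E
    ⊆Z : IsFlat N Y → Y ⊆ Z
    ⊆Z = flat-⊆E N
    fA = flat-restrict⁻ M Z⊆E (proj₁ Z-mod) flat₁
    fB = flat-restrict⁻ M Z⊆E (proj₁ Z-mod) flat₂
    Q : List ℤ
    Q = cofactor M Z-mod Z⊆E (∅-flat M ll) (⊆-min Z)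
    factor : ∀ {F} → IsFlat M F → F ⊆ Z → Disjoint F X → ∀ k → χContr M F k ≡ act Q (χContr N F) k
    factor fF F⊆Z disF k = trans (χContr-factor M Z-mod Z⊆E fF F⊆Z k)
      (act-cofactor-const M (∅-flat M ll) Z-mod Z⊆E X-mod cover fF F⊆Z disF _ k)

  path-complement : C ⊆ E M → Complement M Z C → Path ((M ∣ Z) Z⊆E) A B → Path M (cl M (C ∪ A)) (cl M (C ∪ B))
  path-complement {C = C} C⊆E compl = gmap (λ F → cl M (C ∪ F)) lift
    where
    N = (M ∣ Z) Z⊆E
    lift : ∀ {A B} → Step N A B → Step M (cl M (C ∪ A)) (cl M (C ∪ B))
    lift {A} {B} (step flat₁ flat₂ sub ranks (q , eq)) =
      step (cl-flat M (C∪⊆E flat₁)) (cl-flat M (C∪⊆E flat₂)) (cl-mono M (∪-mono (λ x → x) sub) (C∪⊆E flat₂))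
        (trans (rk flat₂) (trans (cong (r M C ℕ.+_) ranks) (trans (ℕₚ.+-suc (r M C) (r M A)) (cong suc (sym (rk flat₁))))))
        (q , λ k → trans (sym (χContr-complement M Z-mod Z⊆E C⊆E compl flat₁ k))
          (trans (eq k) (act-cong q (χContr-complement M Z-mod Z⊆E C⊆E compl flat₂) k)))
      where
      C∪⊆E : IsFlat N X → C ∪ X ⊆ E M
      C∪⊆E fX = ∪-lub C⊆E (λ x → Z⊆E (flat-⊆E N fX x))
      rk : IsFlat N X → r M (cl M (C ∪ X)) ≡ r M C ℕ.+ r M X
      rk fX = trans (r-cl M (C∪⊆E fX)) (compl-r M Z-mod Z⊆E C⊆E compl (flat-⊆E N fX))

-- The induction over modularly extended matroids

ComplementPath : Matroid n → Subset n → Set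
ComplementPath M X = ∃[ C ] Path M ∅ C × IsFlat M C × Complement M X C

Extensible : Matroid n → Set
Extensible M = ∀ X → Modular M X → RoundIn M X → ComplementPath M X

Loopless-∣ : (M : Matroid n) (Z⊆E : Z ⊆ E M) → Loopless M → Loopless ((M ∣ Z) Z⊆E)
Loopless-∣ M Z⊆E ll e e∈Z = ll e (Z⊆E e∈Z)

module _ (M : Matroid n) (ll : Loopless M) where

  private
    open ℕₚ.≤-Reasoning
    ∅-fl = ∅-flat M ll

  extend-empty : E M ≡ ∅ → Extensible M
  extend-empty E≡∅ X (fX , _) _ = ∅ , ε , ∅-fl , cong₂ ℕ._+_ (r-∅ M) (cong (r M) X≡E) ,
    mono M (λ x → ∪-⊆ʳ (subst (_ ∈_) (sym X≡E) x)) (∪-lub (⊆-min (E M)) (flat-⊆E M fX))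
    where
    X≡E : X ≡ E M
    X≡E = ⊆-antisym (flat-⊆E M fX) (λ x → ⊥-elim (∉⊥ (subst (_ ∈_) E≡∅ x)))

  module _ {Z : Subset n} (Z⊆E : Z ⊆ E M) (Z-mod : Modular M Z) (hyper : suc (r M Z) ≡ rank M)
           (IH : Extensible ((M ∣ Z) Z⊆E)) where

    point-complement : ∀ {h} → h ∈ E M → h ∉ Z → Complement M Z ⁅ h ⁆
    point-complement {h} h∈E h∉Z = trans (cong (ℕ._+ r M Z) (ll h h∈E)) hyper ,
      ℕₚ.≤-trans (ℕₚ.≤-reflexive (sym hyper)) (ℕₚ.≰⇒> (λ le → h∉Z (flat-∈ M (proj₁ Z-mod) h∈E
        (ℕₚ.≤-trans (mono M (∪-lub ∪-⊆ʳ ∪-⊆ˡ) (∪-lub (⁅⁆-⊆ h∈E) Z⊆E)) le))))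

    private
      N : Matroid n
      N = (M ∣ Z) Z⊆E
      E⊈Z : ¬ (E M ⊆ Z)
      E⊈Z E⊆Z = ℕₚ.<-irrefl refl (ℕₚ.≤-trans (ℕₚ.≤-reflexive hyper) (mono M E⊆Z Z⊆E))

    -- X contains every point outside Z, so project X = X ∩ Z.
    coatom-inside : ∀ {X h} → Modular M X → RoundIn M X → E M ⊆ Z ∪ X → h ∈ E M → h ∉ Z → ComplementPath M X
    coatom-inside {X} {h} X-mod@(fX , _) rd cover h∈E h∉Z =
      build (IH (X ∩ Z) (Modular-∩ M Z⊆E (proj₁ Z-mod) X-mod) rd∩)
      where
      h∈X : h ∈ X
      h∈X = [ (λ z → ⊥-elim (h∉Z z)) , (λ x → x) ]′ (x∈p∪q⁻ Z X (cover h∈E))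
      X∪h≡X : X ∪ ⁅ h ⁆ ≡ X
      X∪h≡X = ⊆-antisym (∪-lub (λ x → x) (⁅⁆-⊆ h∈X)) ∪-⊆ˡ
      cl≡X : cl M (X ∪ ⁅ h ⁆) ≡ X
      cl≡X = trans (cong (cl M) X∪h≡X) fX
      -- Roundness does not pass to smaller flats in general; X ∩ Z has it as the image of X under
      -- contraction of h ∈ X.
      rd∩ : RoundIn N (X ∩ Z)
      rd∩ = subst (λ Y → RoundIn N (Y ∩ Z)) cl≡X
              (project-RoundIn M Z-mod Z⊆E (⁅⁆-⊆ h∈E) (point-complement h∈E h∉Z) ll fX rd)
      build : ComplementPath N (X ∩ Z) → ComplementPath M X
      build (D , path , fD , complD) =
        D , path-join M Z-mod Z⊆E X-mod ll cover disj path , flat-restrict⁻ M Z⊆E (proj₁ Z-mod) fD , compl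
        where
        compl : Complement M X D
        compl = Complement-join M Z⊆E Z-mod fX cover (flat-⊆E N fD) complD
        disj : Disjoint D X
        disj = complement⇒disjoint M ll (λ x → Z⊆E (flat-⊆E N fD x)) (flat-⊆E M fX) compl

    -- The point h is a complement of Z, so M/h has the characteristic polynomial of M|Z, which
    -- divides that of M by modularity. The closure of ⁅ h ⁆ ∪ ∅ is the form in which the lifted
    -- chain starts.
    first-step : ∀ {h} (h∈E : h ∈ E M) → Complement M Z ⁅ h ⁆ → Step M ∅ (cl M (⁅ h ⁆ ∪ ∅))
    first-step {h} h∈E compl = step ∅-fl (cl-flat M h∪∅⊆E) (⊆-min _)
      (trans (r-cl M h∪∅⊆E) (trans (cong (r M) (∪-identityʳ ⁅ h ⁆)) (trans (ll h h∈E) (cong suc (sym (r-∅ M))))))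
      (Q , factor)
      where
      h∪∅⊆E : ⁅ h ⁆ ∪ ∅ ⊆ E M
      h∪∅⊆E = ∪-lub (⁅⁆-⊆ h∈E) (⊆-min (E M))
      Q : List ℤ
      Q = cofactor M Z-mod Z⊆E ∅-fl (⊆-min Z)
      factor : ∀ k → χContr M ∅ k ≡ act Q (χContr M (cl M (⁅ h ⁆ ∪ ∅))) k
      factor k = trans (χContr-factor M Z-mod Z⊆E ∅-fl (⊆-min Z) k) (act-cong Q
        (χContr-complement M Z-mod Z⊆E (⁅⁆-⊆ h∈E) compl (∅-flat N (Loopless-∣ M Z⊆E ll))) k)

    coatom-outside : ∀ {X h} → Modular M X → RoundIn M X → h ∈ E M → h ∉ Z → h ∉ X → ComplementPath M X
    coatom-outside {X} {h} X-mod@(fX , _) rd h∈E h∉Z h∉X =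
      build (IH X′ (project-Modular M Z-mod Z⊆E h⊆E compl X-mod) (project-RoundIn M Z-mod Z⊆E h⊆E compl ll fX rd))
      where
      h⊆E : ⁅ h ⁆ ⊆ E M
      h⊆E = ⁅⁆-⊆ h∈E
      X⊆E : X ⊆ E M
      X⊆E = flat-⊆E M fX
      compl : Complement M Z ⁅ h ⁆
      compl = point-complement h∈E h∉Z
      X′ : Subset n
      X′ = project M Z-mod Z⊆E h⊆E compl X
      -- Since h ∉ X, joining h raises the rank by one, and contracting h lowers it again.
      rX′ : r M X′ ≡ r M X
      rX′ = ℕₚ.suc-injective (trans (cong (ℕ._+ r M X′) (sym (ll h h∈E))) (trans (r-project M Z-mod Z⊆E h⊆E compl X⊆E)
        (ℕₚ.≤-antisym
          (ℕₚ.≤-trans (r-∪ M X⊆E h⊆E) (ℕₚ.≤-reflexive (trans (cong (r M X ℕ.+_) (ll h h∈E)) (ℕₚ.+-comm (r M X) 1))))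
          (ℕₚ.≰⇒> (λ le → h∉X (flat-∈ M fX h∈E le))))))
      build : ComplementPath N X′ → ComplementPath M X
      build (D , path , fD , complD) =
        W , first-step h∈E compl ◅ path-complement M Z-mod Z⊆E h⊆E compl path , cl-flat M h∪D⊆E ,
        (trans (cong (r M W ℕ.+_) (sym rX′)) (proj₁ complW) , (begin
          rank M               ≤⟨ proj₂ complW ⟩
          r M (W ∪ X′)         ≤⟨ mono M (∪-lub (λ x → ⊆-cl M W∪X⊆E (∪-⊆ˡ x)) X′⊆) (cl-⊆E M {X = W ∪ X}) ⟩
          r M (cl M (W ∪ X))   ≡⟨ r-cl M W∪X⊆E ⟩
          r M (W ∪ X) ∎))
        where
        D⊆Z : D ⊆ Z
        D⊆Z = flat-⊆E N fD
        h∪D⊆E : ⁅ h ⁆ ∪ D ⊆ E M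
        h∪D⊆E = ∪-lub h⊆E (λ x → Z⊆E (D⊆Z x))
        W : Subset n
        W = cl M (⁅ h ⁆ ∪ D)
        complW : Complement M X′ W
        complW = Complement-trans M Z-mod Z⊆E h⊆E compl ∩-⊆ʳ D⊆Z complD
        W∪X⊆E : W ∪ X ⊆ E M
        W∪X⊆E = ∪-lub (cl-⊆E M {X = ⁅ h ⁆ ∪ D}) X⊆E
        -- W contains h, so W ∨ X contains X ∨ h and with it X′. This turns a complement of X′ into
        -- one of X.
        X′⊆ : X′ ⊆ cl M (W ∪ X)
        X′⊆ x = cl-mono M (∪-lub ∪-⊆ʳ (λ y → ∪-⊆ˡ (⊆-cl M h∪D⊆E (∪-⊆ˡ y)))) W∪X⊆E (∩-⊆ˡ x)

    extend-coatom : Extensible M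
    extend-coatom X X-mod rd with E M ⊆? Z ∪ X
    ... | no ¬cover with ⊈⇒∃ ¬cover
    ... | h , h∈E , h∉Z∪X = coatom-outside X-mod rd h∈E (λ z → h∉Z∪X (∪-⊆ˡ z)) (λ x → h∉Z∪X (∪-⊆ʳ x))
    extend-coatom X X-mod rd | yes cover with ⊈⇒∃ {A = E M} {B = Z} E⊈Z
    ... | h , h∈E , h∉Z = coatom-inside X-mod rd cover h∈E h∉Z

  module _ {E₁ E₂ : Subset n} (E₁⊆E : E₁ ⊆ E M) (E₂⊆E : E₂ ⊆ E M) (mod₁ : Modular M E₁) (mod₂ : Modular M E₂)
           (cover : E M ⊆ E₂ ∪ E₁) (round : RoundIn M (E₁ ∩ E₂))
           (IH₁ : Extensible ((M ∣ E₁) E₁⊆E)) (IH₂ : Extensible ((M ∣ E₂) E₂⊆E)) where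

    extend-join : ∀ X → X ⊆ E₁ → Modular M X → RoundIn M X → ComplementPath M X
    extend-join X X⊆E₁ X-mod rd = build
      (IH₂ (E₁ ∩ E₂) (Modular-∩ M E₂⊆E (proj₁ mod₂) mod₁) (RoundIn-restrict M E₂⊆E (proj₁ mod₂) round))
      (IH₁ X (subst (Modular N₁) (⊆-antisym ∩-⊆ˡ (∩-glb (λ x → x) X⊆E₁)) (Modular-∩ M E₁⊆E (proj₁ mod₁) X-mod))
             (RoundIn-restrict M E₁⊆E (proj₁ mod₁) rd))
      where
      N₁ N₂ : Matroid n
      N₁ = (M ∣ E₁) E₁⊆E
      N₂ = (M ∣ E₂) E₂⊆E
      build : ComplementPath N₂ (E₁ ∩ E₂) → ComplementPath N₁ X → ComplementPath M X
      build (D₂ , path₂ , fD₂ , complD₂) (D₁ , path₁ , fD₁ , complD₁) =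
        cl M (D₂ ∪ D₁) , lower ◅◅ upper , cl-flat M (∪-lub D₂⊆E (λ x → E₁⊆E (flat-⊆E N₁ fD₁ x))) ,
        Complement-trans M mod₁ E₁⊆E D₂⊆E compl₂ X⊆E₁ (flat-⊆E N₁ fD₁) complD₁
        where
        D₂⊆E : D₂ ⊆ E M
        D₂⊆E x = E₂⊆E (flat-⊆E N₂ fD₂ x)
        compl₂ : Complement M E₁ D₂
        compl₂ = Complement-join M E₂⊆E mod₂ (proj₁ mod₁) cover (flat-⊆E N₂ fD₂) complD₂
        -- The chain lifted from M|E₁ starts at the image of ∅, which has to match the end of the
        -- chain from M|E₂.
        cl≡ : cl M (D₂ ∪ ∅) ≡ D₂
        cl≡ = trans (cong (cl M) (∪-identityʳ D₂)) (flat-restrict⁻ M E₂⊆E (proj₁ mod₂) fD₂)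
        lower : Path M ∅ D₂
        lower = path-join M mod₂ E₂⊆E mod₁ ll cover (complement⇒disjoint M ll D₂⊆E E₁⊆E compl₂) path₂
        upper : Path M D₂ (cl M (D₂ ∪ D₁))
        upper = subst (λ S → Path M S (cl M (D₂ ∪ D₁))) cl≡ (path-complement M mod₁ E₁⊆E D₂⊆E compl₂ path₁)

ME⇒Extensible : (M : Matroid n) → Loopless M → ME M → Extensible M
ME⇒Extensible M ll (empty M E≡∅) = extend-empty M ll E≡∅
ME⇒Extensible M ll (coatom M _ Z Z⊆E Z-mod (_ , hyper) me) =
  extend-coatom M ll Z⊆E (IsModularFlat⇒Modular M Z-mod) hyper (ME⇒Extensible _ (Loopless-∣ M Z⊆E ll) me)
ME⇒Extensible M ll (join M _ E₁ E₂ E₁⊆E E₂⊆E (E≡ , _ , mf₁ , _ , mf₂) fY Y⊆E round me₁ me₂) X X-mod rd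
  = [ inE₁ , inE₂ ]′ (rd E₁ E₂ (proj₁ mf₁) (proj₁ mf₂) (λ x → subst (_ ∈_) E≡ (flat-⊆E M (proj₁ X-mod) x)))
  where
  mod₁ = IsModularFlat⇒Modular M mf₁
  mod₂ = IsModularFlat⇒Modular M mf₂
  ih₁ = ME⇒Extensible _ (Loopless-∣ M E₁⊆E ll) me₁
  ih₂ = ME⇒Extensible _ (Loopless-∣ M E₂⊆E ll) me₂
  roundY = Round⇒RoundIn M Y⊆E fY round
  inE₁ : X ⊆ E₁ → ComplementPath M X
  inE₁ X⊆E₁ = extend-join M ll E₁⊆E E₂⊆E mod₁ mod₂ (λ x → subst (_ ∈_) (trans E≡ (∪-comm E₁ E₂)) x) roundY ih₁ ih₂ X X⊆E₁ X-mod rd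
  inE₂ : X ⊆ E₂ → ComplementPath M X
  inE₂ X⊆E₂ = extend-join M ll E₂⊆E E₁⊆E mod₂ mod₁ (λ x → subst (_ ∈_) E≡ x) (subst (RoundIn M) (∩-comm E₁ E₂) roundY) ih₂ ih₁ X X⊆E₂ X-mod rd

-- From chains to divisional flags

module _ (M : Matroid n) where

  private
    ∣ₚ-act : ∀ {d p} → d ∣ᵃ p → d ∣ₚ p
    ∣ₚ-act {d} (q , eq) = q , λ k → trans (eq k) (sym (polyMul≡act q d k))

  -- A flag is a function on all of ℕ, so beyond its end the chain is continued by its last flat.
  at : Path M A B → ℕ → Subset n
  at {A = A} ε       i       = A
  at {A = A} (s ◅ p) zero    = A
  at         (s ◅ p) (suc i) = at p i

  at-0 : (p : Path M A B) → at p 0 ≡ A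
  at-0 ε       = refl
  at-0 (s ◅ p) = refl

  at-end : ∀ (p : Path M A B) j → r M B ≡ j ℕ.+ r M A → at p j ≡ B
  at-end ε       j       _  = refl
  at-end {A = A} (s ◅ p) zero    eq = ⊥-elim (ℕₚ.<-irrefl refl (ℕₚ.≤-trans (ℕₚ.≤-reflexive (sym (Step.ranks s)))
    (ℕₚ.≤-trans (path-r p) (ℕₚ.≤-reflexive eq))))
    where
    path-r : ∀ {A B} → Path M A B → r M A ≤ r M B
    path-r ε       = ℕₚ.≤-refl
    path-r (s ◅ p) = ℕₚ.≤-trans (ℕₚ.n≤1+n _) (ℕₚ.≤-trans (ℕₚ.≤-reflexive (sym (Step.ranks s))) (path-r p))
  at-end {A = A} (s ◅ p) (suc j) eq = at-end p j (trans eq (trans (sym (ℕₚ.+-suc j (r M A))) (cong (j ℕ.+_) (sym (Step.ranks s)))))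

  at-flat : (p : Path M A B) → IsFlat M A → ∀ i → i ℕ.+ r M A ≤ r M B → IsFlat M (at p i) × r M (at p i) ≡ i ℕ.+ r M A
  at-flat {A = A} ε fA zero le = fA , refl
  at-flat {A = A} ε fA (suc i) le = ⊥-elim (ℕₚ.<-irrefl refl (ℕₚ.≤-trans (s≤s (ℕₚ.m≤n+m (r M A) i)) le))
  at-flat (s ◅ p) fA zero le = fA , refl
  at-flat {A = A} (s ◅ p) fA (suc i) le =
    let shiftr = trans (cong (i ℕ.+_) (Step.ranks s)) (ℕₚ.+-suc i (r M A))
        fl , eq = at-flat p (Step.flat₂ s) i (ℕₚ.≤-trans (ℕₚ.≤-reflexive shiftr) le)
    in fl , trans eq shiftr

  at-step : (p : Path M A B) → ∀ i → i ℕ.+ r M A < r M B → Step M (at p i) (at p (suc i))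
  at-step {A = A} ε i lt = ⊥-elim (ℕₚ.<-irrefl refl (ℕₚ.≤-trans (s≤s (ℕₚ.m≤n+m (r M A) i)) lt))
  at-step (s ◅ p) zero lt = subst (Step M _) (sym (at-0 p)) s
  at-step {A = A} (s ◅ p) (suc i) lt = at-step p i
    (ℕₚ.≤-trans (s≤s (ℕₚ.≤-reflexive (trans (cong (i ℕ.+_) (Step.ranks s)) (ℕₚ.+-suc i (r M A))))) lt)

  path⇒flag : IsFlat M ∅ → Path M ∅ (E M) → HasDivisionalFlag M
  path⇒flag ∅-fl p = at p , at-0 p ,
    at-end p (rank M) (sym (+r∅ (rank M))) ,
    (λ i le → let fl , eq = at-flat p ∅-fl i (ℕₚ.≤-trans (ℕₚ.≤-reflexive (+r∅ i)) le) in fl , trans eq (+r∅ i)) ,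
    (λ i lt → Step.sub (at-step p i (lower i lt))) ,
    (λ i lt → ∣ₚ-act (Step.divs (at-step p i (lower i lt))))
    where
    +r∅ : ∀ i → i ℕ.+ r M ∅ ≡ i
    +r∅ i = trans (cong (i ℕ.+_) (r-∅ M)) (ℕₚ.+-identityʳ i)
    lower : ∀ i → i < rank M → i ℕ.+ r M ∅ < rank M
    lower i lt = ℕₚ.≤-trans (s≤s (ℕₚ.≤-reflexive (+r∅ i))) lt

theorem1p8 : ∀ {n : ℕ} (M : Matroid n) → Simple M → ME M → HasDivisionalFlag M
theorem1p8 M (ll , _) me = path⇒flag M ∅-fl (subst (Path M ∅) C≡E (proj₁ (proj₂ flag)))
  where
  ∅-fl = ∅-flat M ll
  -- The empty flat is trivially modular and round, and a complement of it has full rank.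
  flag : ComplementPath M ∅
  flag = ME⇒Extensible M ll me ∅
    (∅-fl , λ Y fY → ℕₚ.≤-trans (ℕₚ.≤-reflexive (cong (ℕ._+ r M Y) (r-∅ M)))
      (ℕₚ.≤-trans (mono M ∪-⊆ʳ (∪-lub (⊆-min _) (flat-⊆E M fY))) (ℕₚ.m≤n+m (r M (∅ ∪ Y)) (r M (∅ ∩ Y)))))
    (λ A B _ _ _ → inj₁ (⊆-min A))
  fC = proj₁ (proj₂ (proj₂ flag))
  C≡E : proj₁ flag ≡ E M
  C≡E = flat-≤ M fC (flat-⊆E M fC) (λ x → x) (ℕₚ.≤-reflexive (sym (trans
    (sym (trans (cong (r M (proj₁ flag) ℕ.+_) (r-∅ M)) (ℕₚ.+-identityʳ _))) (proj₁ (proj₂ (proj₂ (proj₂ flag)))))))
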